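{- There is an algorithm which, on every input consisting of integers $0\le m_1\le\dots\le m_k$ and a sequence $T_1,\dots,T_n\in\{H,L\}$ with $0\le H<L$ and $n=\sum_r m_r$, outputs exactly the same decision sequence as Algorithm 1, using $O(n\cdot k^2)$ time and $O(k^2)$ working space (beyond the input and output), in the unit-cost RAM model.
   Context: Algorithm 1 (simulation-based threshold algorithm). Input: integers $0\le m_1\le\dots\le m_k$ and a sequence $T_1,\dots,T_n$ with $n=\sum_r m_r$. Set $q^{(1)}_r=m_r$ for all $r$. For $t=1,\dots,n$: set $x_t=\mathrm{TA}(q^{(t)}_1,\dots,q^{(t)}_k;\,T_t,T_{t+1},\dots,T_n)$ and $q^{(t+1)}_r=q^{(t)}_r-\mathbf{1}(x_t=r)$ for each $r$. Output $\mathbf{x}=(x_1,\dots,x_n)$. Subroutine $\mathrm{TA}(m_1,\dots,m_k;\,S_1,\dots,S_N)$ (ThresholdAllocation), with the convention $m_0:=0$: for $\gamma=k,k-1,\dots,1$: if $m_\gamma=m_{\gamma-1}$, go to the next $\gamma$; otherwise, for $h=\gamma,\gamma+1,\dots,k$: let $Z_L=\sum_{i=1}^{h-1}\min\{m_i,m_{\gamma-1}\}$ and $Z_H=\sum_{i=\gamma}^{h}(m_i-m_{\gamma-1})$; if $|\{i\in\{1,\dots,Z_L+Z_H\}: S_i>S_1\}|\ge Z_L$, return $\gamma$ (agent to which $S_1$ is assigned). -}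

module Defs where

open import Data.Bool.Base using (Bool; if_then_else_)
open import Data.Bool.ListAction using (any)
open import Data.List.Base
  using (List; []; _∷_; _∷ʳ_; length; map; filter; take; applyUpTo)
open import Data.List.Relation.Unary.All using (All)
open import Data.Maybe.Base as Maybe using (Maybe; just; nothing; fromMaybe; _>>=_)
open import Data.Nat.Base
open import Data.Nat.ListAction using (sum)
open import Level using (0ℓ)
open import Relation.Binary.Bundles using (StrictTotalOrder)
open import Relation.Binary.PropositionalEquality using (_≡_)
open import Relation.Nullary.Decidable using (does)

-- Positions in lists count from 1; position 0 is always out of range.
nth : ∀ {a} {A : Set a} → List A → ℕ → Maybe A
nth _        zero          = nothing
nth []       (suc _)       = nothing
nth (x ∷ _)  (suc zero)    = just x
nth (_ ∷ xs) (suc (suc i)) = nth xs (suc i)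

-- In particular m ‼ 0 is 0, the convention m₀ := 0.
_‼_ : List ℕ → ℕ → ℕ
m ‼ i = fromMaybe 0 (nth m i)

infix 8 _‼_

-- The integers a, a + 1, …, b in increasing order (none if b < a).
_⋯_ : ℕ → ℕ → List ℕ
a ⋯ b = applyUpTo (a +_) (suc b ∸ a)

Σ[_⋯_] : ℕ → ℕ → (ℕ → ℕ) → ℕ
Σ[ a ⋯ b ] f = sum (map f (a ⋯ b))

decrementAt : ℕ → List ℕ → List ℕ
decrementAt zero          q       = q
decrementAt (suc _)       []      = []
decrementAt (suc zero)    (x ∷ q) = x ∸ 1 ∷ q
decrementAt (suc (suc r)) (x ∷ q) = x ∷ decrementAt (suc r) q

Z-L Z-H : List ℕ → (γ h : ℕ) → ℕ
Z-L m γ h = Σ[ 1 ⋯ h ∸ 1 ] (λ i → m ‼ i ⊓ m ‼ (γ ∸ 1))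
-- Truncated subtraction is exact here whenever m is nondecreasing, because
-- i ≥ γ; Algorithm 1 keeps its quotas nondecreasing.
Z-H m γ h = Σ[ γ ⋯ h ] (λ i → m ‼ i ∸ m ‼ (γ ∸ 1))

-- The values of the sequence T are only ever compared with each other, so they
-- range over an arbitrary decidable strict total order.
module ThresholdAlgorithm (V : StrictTotalOrder 0ℓ 0ℓ 0ℓ) where

  open StrictTotalOrder V using (_<?_) renaming (Carrier to Value)

  -- |{ i ∈ {1, …, z} : Sᵢ > s }|
  countAbove : Value → ℕ → List Value → ℕ
  countAbove s z S = length (filter (s <?_) (take z S))

  accepts : List ℕ → Value → List Value → (γ h : ℕ) → Bool
  accepts m s S γ h = Z-L m γ h ≤ᵇ countAbove s (Z-L m γ h + Z-H m γ h) S

  -- The loop over γ, started at its argument and running down to 1; `nothing`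
  -- means that it ends without returning an agent.
  TA-from : ℕ → List ℕ → Value → List Value → Maybe ℕ
  TA-from zero      m s S = nothing
  TA-from γ@(suc γ-1) m s S =
    if m ‼ γ ≡ᵇ m ‼ γ-1 then TA-from γ-1 m s S
    else if any (accepts m s S γ) (γ ⋯ length m) then just γ
    else TA-from γ-1 m s S

  -- TA m s S is TA(m₁, …, m_k; S₁, …, S_N), where s is the first entry S₁ of S.
  TA : List ℕ → Value → List Value → Maybe ℕ
  TA m = TA-from (length m) m

  -- `nothing` if some call to TA returns no agent.
  algorithm1 : List ℕ → List Value → Maybe (List ℕ)
  algorithm1 q []          = just []
  algorithm1 q S@(s ∷ S′) =
    TA q s S >>= λ x → Maybe.map (x ∷_) (algorithm1 (decrementAt x q) S′)

-- Unit-cost random access machine.  The working memory is an array of cells,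
-- each holding a natural number and initially 0.  Besides it there are a
-- read-only input (k, n, the mᵣ and the Tᵢ) and a write-only output sequence.
-- Arithmetic is limited to addition and truncated subtraction, and the Tᵢ can
-- only be compared with each other in place, never copied to the working memory.

Address Label : Set
Address = ℕ
Label   = ℕ

-- A destination cell comes first.  Labels are positions in the program,
-- starting from 0.
data Instr : Set where
  const   : (d : Address) (v : ℕ) → Instr
  copy    : (d a : Address) → Instr
  add sub : (d a b : Address) → Instr
  load    : (d a : Address) → Instr             -- cell d := cell (cell a)
  store   : (a b : Address) → Instr             -- cell (cell a) := cell b
  jump    : (l : Label) → Instr
  jump<   : (a b : Address) (l : Label) → Instr -- if cell a < cell b
  getK    : (d : Address) → Instr
  getN    : (d : Address) → Instr
  getM    : (d a : Address) → Instr             -- cell d := m at position (cell a)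
  jumpT<  : (a b : Address) (l : Label) → Instr -- if T at (cell a) < T at (cell b)
  emit    : (a : Address) → Instr
  halt    : Instr

Program : Set
Program = List Instr

Memory : Set
Memory = Address → ℕ

_[_≔_] : Memory → Address → ℕ → Memory
(μ [ d ≔ v ]) a = if a ≡ᵇ d then v else μ a

record Config : Set where
  constructor ⟨_,_,_⟩
  field
    pc     : Label
    memory : Memory
    output : List ℕ

-- The working cells read or written by an instruction.
cells : Instr → Memory → List Address
cells (const d v)    μ = d ∷ []
cells (copy d a)     μ = d ∷ a ∷ []
cells (add d a b)    μ = d ∷ a ∷ b ∷ []
cells (sub d a b)    μ = d ∷ a ∷ b ∷ []
cells (load d a)     μ = d ∷ a ∷ μ a ∷ []
cells (store a b)    μ = a ∷ b ∷ μ a ∷ []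
cells (jump l)       μ = []
cells (jump< a b l)  μ = a ∷ b ∷ []
cells (getK d)       μ = d ∷ []
cells (getN d)       μ = d ∷ []
cells (getM d a)     μ = d ∷ a ∷ []
cells (jumpT< a b l) μ = a ∷ b ∷ []
cells (emit a)       μ = a ∷ []
cells halt           μ = []

fetch : Program → Label → Maybe Instr
fetch p l = nth p (suc l)

module Machine (V : StrictTotalOrder 0ℓ 0ℓ 0ℓ) where

  open StrictTotalOrder V using (_<?_) renaming (Carrier to Value)

  -- `nothing` on halting and on reading the input out of range.
  step : (m : List ℕ) (T : List Value) → Instr → Config → Maybe Config
  step m T (const d v)    ⟨ l , μ , o ⟩ = just ⟨ suc l , μ [ d ≔ v ] , o ⟩
  step m T (copy d a)     ⟨ l , μ , o ⟩ = just ⟨ suc l , μ [ d ≔ μ a ] , o ⟩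
  step m T (add d a b)    ⟨ l , μ , o ⟩ = just ⟨ suc l , μ [ d ≔ μ a + μ b ] , o ⟩
  step m T (sub d a b)    ⟨ l , μ , o ⟩ = just ⟨ suc l , μ [ d ≔ μ a ∸ μ b ] , o ⟩
  step m T (load d a)     ⟨ l , μ , o ⟩ = just ⟨ suc l , μ [ d ≔ μ (μ a) ] , o ⟩
  step m T (store a b)    ⟨ l , μ , o ⟩ = just ⟨ suc l , μ [ μ a ≔ μ b ] , o ⟩
  step m T (jump l′)      ⟨ l , μ , o ⟩ = just ⟨ l′ , μ , o ⟩
  step m T (jump< a b l′) ⟨ l , μ , o ⟩ =
    just ⟨ (if μ a <ᵇ μ b then l′ else suc l) , μ , o ⟩
  step m T (getK d)       ⟨ l , μ , o ⟩ = just ⟨ suc l , μ [ d ≔ length m ] , o ⟩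
  step m T (getN d)       ⟨ l , μ , o ⟩ = just ⟨ suc l , μ [ d ≔ length T ] , o ⟩
  step m T (getM d a)     ⟨ l , μ , o ⟩ =
    nth m (μ a) >>= λ v → just ⟨ suc l , μ [ d ≔ v ] , o ⟩
  step m T (jumpT< a b l′) ⟨ l , μ , o ⟩ =
    nth T (μ a) >>= λ x → nth T (μ b) >>= λ y →
    just ⟨ (if does (x <? y) then l′ else suc l) , μ , o ⟩
  step m T (emit a)       ⟨ l , μ , o ⟩ = just ⟨ suc l , μ , o ∷ʳ μ a ⟩
  step m T halt           _             = nothing

  -- Halts p m T s c t x: started from c, program p halts after executing t
  -- instructions with output x, and touches only the cells 0, …, s - 1.
  data Halts (p : Program) (m : List ℕ) (T : List Value) (s : ℕ) :
             Config → ℕ → List ℕ → Set where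
    stop : ∀ {c} → fetch p (Config.pc c) ≡ just halt →
           Halts p m T s c 1 (Config.output c)
    next : ∀ {c c′ i t x} →
           fetch p (Config.pc c) ≡ just i →
           All (_< s) (cells i (Config.memory c)) →
           step m T i c ≡ just c′ →
           Halts p m T s c′ t x →
           Halts p m T s c (suc t) x

  start : Config
  start = ⟨ 0 , (λ _ → 0) , [] ⟩

  -- On input (m, T), p outputs x in time t using s working cells.
  Computes : Program → (m : List ℕ) (T : List Value) (x : List ℕ) (t s : ℕ) → Set
  Computes p m T x t s = Halts p m T s start t x

{-# OPTIONS --safe #-}

-- For γ = g + 1 and quotas q the window inspected by ThresholdAllocation at
-- time t = tm + 1 ends at position tm + (q₁ + … + q_h) − q_g of T, where q is
-- nondecreasing.  When one quota is decremented and t advances, this position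
-- stays or moves forward by one.  So for each pair (γ , h) it is enough to keep
-- a pointer e to the end of the window and the number c of L's among T₁, …, Tₑ:
-- every decision costs O(1) per pair, and n sweeps in which each pointer
-- advances by at most one bring all pointers to their initial positions.  An
-- H-entry is recognised by comparison with a minimal entry of T; for an L-entry
-- the count in every window is 0.
module Submission where

open import Defs
open import Data.Bool.Base using (Bool; true; false; if_then_else_; _∧_; _∨_) renaming (T to Holds)
open import Data.Bool.ListAction using (any)
open import Data.Bool.Properties using (∨-assoc; ∨-identityʳ)
open import Data.Empty using (⊥-elim)
open import Data.List.Base using (List; []; _∷_; _∷ʳ_; _++_; length; map; drop; applyUpTo)
open import Data.List.Properties using (++-identityʳ; ∷ʳ-++; applyUpTo-∷ʳ; map-++)
open import Data.List.Relation.Unary.All as All using (All; []; _∷_)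
open import Data.List.Relation.Unary.All.Properties using (drop⁺)
open import Data.List.Relation.Unary.Linked using ([-]; _∷_)
open import Data.List.Relation.Unary.Sorted.TotalOrder using (Sorted)
open import Data.Maybe.Base using (just; fromMaybe; _>>=_)
open import Data.Nat.Base hiding (_<_)
open import Data.Nat.ListAction using (sum)
open import Data.Nat.ListAction.Properties using (sum-++)
open import Data.Nat.Properties hiding (_<?_)
open import Data.Nat.Solver using (module +-*-Solver)
open import Data.Product using (∃-syntax; _×_; _,_; proj₁; proj₂)
open import Data.Sum.Base using (_⊎_; inj₁; inj₂)
open import Data.Vec.Base using (Vec; []; _∷_; replicate)
open import Function.Base using (_∘_; _$_)
open import Level using (0ℓ)
open import Relation.Binary.Bundles using (StrictTotalOrder)
open import Relation.Binary.Definitions using (tri<; tri≈; tri>)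
open import Relation.Binary.PropositionalEquality
open import Relation.Nullary.Decidable.Core using (Dec; does; yes; no)
open import Relation.Nullary.Negation.Core using (¬_; contradiction)

-- The machine sees neither H nor L, only the outcomes of comparisons. Counts are therefore taken
-- relative to a minimal entry `v₀`; if every entry is an L they are all 0, and so are the counts in
-- Algorithm 1. The number of L's in a window is a difference of two prefix counts, while
-- subtracting `n` instead truncates to the 0 that belongs to an L-entry, so one acceptance test
-- serves both kinds of entry. The other obstacle is that the initial window ends may be as far as
-- `n` from the start, whereas a sweep moves a pointer by at most one. The lag of the pointers is
-- therefore part of the invariant: a sweep lowers the bound on it by one, a decision raises it from
-- 0 to 1. A single sweep lemma then covers the warm-up, where nothing is claimed about the
-- decision, and the real rounds, where lag 0 makes the counts exact.

module _ where

  open import Data.Nat.Base using (_<_)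

  -- Lists indexed from 1, prefix sums and nondecreasing quotas

  nth-length : ∀ {a} {A : Set a} (xs : List A) {i} → i < length xs →
               ∃[ x ] nth xs (suc i) ≡ just x
  nth-length (x ∷ xs) {zero}  i<       = x , refl
  nth-length (x ∷ xs) {suc i} (s≤s i<) = nth-length xs i<

  nth-drop : ∀ {a} {A : Set a} (xs : List A) i {y ys} → drop i xs ≡ y ∷ ys →
             nth xs (suc i) ≡ just y
  nth-drop (x ∷ xs) zero    refl = refl
  nth-drop (x ∷ xs) (suc i) eq   = nth-drop xs i eq

  drop-suc : ∀ {a} {A : Set a} (xs : List A) i {y ys} → drop i xs ≡ y ∷ ys →
             drop (suc i) xs ≡ ys
  drop-suc (x ∷ xs) zero    refl = refl
  drop-suc (x ∷ xs) (suc i) eq   = drop-suc xs i eq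

  All-nth : ∀ {a p} {A : Set a} {P : A → Set p} {xs : List A} → All P xs →
            ∀ i {x} → nth xs i ≡ just x → P x
  All-nth (px ∷ pxs) (suc zero)    refl = px
  All-nth (px ∷ pxs) (suc (suc i)) eq   = All-nth pxs (suc i) eq

  prefix : List ℕ → ℕ → ℕ
  prefix q zero    = 0
  prefix q (suc h) = prefix q h + q ‼ suc h

  prefix-∷ : ∀ x q h → prefix (x ∷ q) (suc h) ≡ x + prefix q h
  prefix-∷ x q zero    = +-comm 0 x
  prefix-∷ x q (suc h) =
    trans (cong (_+ q ‼ suc h) (prefix-∷ x q h)) (+-assoc x (prefix q h) (q ‼ suc h))

  sum≡prefix : ∀ q → sum q ≡ prefix q (length q)
  sum≡prefix []      = refl
  sum≡prefix (x ∷ q) = trans (cong (x +_) (sum≡prefix q)) (sym (prefix-∷ x q (length q)))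

  prefix-mono : ∀ q {h h′} → h ≤′ h′ → prefix q h ≤ prefix q h′
  prefix-mono q ≤′-refl        = ≤-refl
  prefix-mono q (≤′-step h≤h′) = ≤-trans (prefix-mono q h≤h′) (m≤m+n _ _)

  -- The convention q ‼ 0 = 0 makes i = 0 a harmless case.
  Monotone : List ℕ → Set
  Monotone q = ∀ i → i < length q → q ‼ i ≤ q ‼ suc i

  Sorted⇒Monotone : ∀ {q} → Sorted ≤-totalOrder q → Monotone q
  Sorted⇒Monotone {q}     s       zero          i<       = z≤n
  Sorted⇒Monotone         (x≤ ∷ s) (suc zero)    (s≤s i<) = x≤
  Sorted⇒Monotone         (x≤ ∷ s) (suc (suc i)) (s≤s i<) = Sorted⇒Monotone s (suc i) i<
  Sorted⇒Monotone         [-]      (suc i)       (s≤s ())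

  ‼-mono : ∀ q → Monotone q → ∀ {i j} → i ≤′ j → j ≤ length q → q ‼ i ≤ q ‼ j
  ‼-mono q mono ≤′-refl       j≤ = ≤-refl
  ‼-mono q mono (≤′-step i≤j) j≤ =
    ≤-trans (‼-mono q mono i≤j (<⇒≤ j≤)) (mono _ j≤)

  prefix≡0 : ∀ q → Monotone q → ∀ {g} → g ≤ length q → q ‼ g ≡ 0 →
             ∀ h → h ≤ g → prefix q h ≡ 0
  prefix≡0 q mono g≤ qg≡0 zero    h≤g = refl
  prefix≡0 q mono g≤ qg≡0 (suc h) h≤g = cong₂ _+_ (prefix≡0 q mono g≤ qg≡0 h (<⇒≤ h≤g))
    (n≤0⇒n≡0 (≤-trans (‼-mono q mono (≤⇒≤′ h≤g) g≤) (≤-reflexive qg≡0)))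

  -- The effect of decrementing one quota

  length-decrementAt : ∀ r q → length (decrementAt r q) ≡ length q
  length-decrementAt zero          q       = refl
  length-decrementAt (suc r)       []      = refl
  length-decrementAt (suc zero)    (x ∷ q) = refl
  length-decrementAt (suc (suc r)) (x ∷ q) = cong suc (length-decrementAt (suc r) q)

  decrementAt-same : ∀ r q → decrementAt r q ‼ r ≡ q ‼ r ∸ 1
  decrementAt-same zero          q       = refl
  decrementAt-same (suc r)       []      = refl
  decrementAt-same (suc zero)    (x ∷ q) = refl
  decrementAt-same (suc (suc r)) (x ∷ q) = decrementAt-same (suc r) q

  decrementAt-other : ∀ r q {i} → i ≢ r → decrementAt r q ‼ i ≡ q ‼ i
  decrementAt-other zero          q       {i}           i≢r = refl
  decrementAt-other (suc r)       []      {i}           i≢r = refl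
  decrementAt-other (suc zero)    (x ∷ q) {zero}        i≢r = refl
  decrementAt-other (suc zero)    (x ∷ q) {suc zero}    i≢r = ⊥-elim (i≢r refl)
  decrementAt-other (suc zero)    (x ∷ q) {suc (suc i)} i≢r = refl
  decrementAt-other (suc (suc r)) (x ∷ q) {zero}        i≢r = refl
  decrementAt-other (suc (suc r)) (x ∷ q) {suc zero}    i≢r = refl
  decrementAt-other (suc (suc r)) (x ∷ q) {suc (suc i)} i≢r =
    decrementAt-other (suc r) q (i≢r ∘ cong suc)

  prefix-decrementAt-< : ∀ r q h → h < r → prefix (decrementAt r q) h ≡ prefix q h
  prefix-decrementAt-< r q zero    h<r = refl
  prefix-decrementAt-< r q (suc h) h<r =
    cong₂ _+_ (prefix-decrementAt-< r q h (<⇒≤ h<r)) (decrementAt-other r q (<⇒≢ h<r))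

  prefix-decrementAt-≥ : ∀ r q h → 0 < q ‼ r → r ≤′ h →
                         suc (prefix (decrementAt r q) h) ≡ prefix q h
  prefix-decrementAt-≥ (suc r) q .(suc r) 0<q ≤′-refl =
    trans (sym (+-suc _ _))
    (cong₂ _+_ (prefix-decrementAt-< (suc r) q r ≤-refl)
               (trans (cong suc (decrementAt-same (suc r) q)) (m+[n∸m]≡n 0<q)))
  prefix-decrementAt-≥ r q (suc h) 0<q (≤′-step r≤h) =
    cong₂ _+_ (prefix-decrementAt-≥ r q h 0<q r≤h)
              (decrementAt-other r q (>⇒≢ (s≤s (≤′⇒≤ r≤h))))

  sum-decrementAt : ∀ r q → 0 < q ‼ r → r ≤ length q → suc (sum (decrementAt r q)) ≡ sum q
  sum-decrementAt r q 0<q r≤ = begin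
    suc (sum q′)                  ≡⟨ cong suc (sum≡prefix q′) ⟩
    suc (prefix q′ (length q′))   ≡⟨ cong (suc ∘ prefix q′) (length-decrementAt r q) ⟩
    suc (prefix q′ (length q))    ≡⟨ prefix-decrementAt-≥ r q (length q) 0<q (≤⇒≤′ r≤) ⟩
    prefix q (length q)           ≡⟨ sum≡prefix q ⟨
    sum q                         ∎
    where
    open ≡-Reasoning
    q′ = decrementAt r q

  -- The strict step below position `suc g` leaves room for the decrement. `TA` returns only agents
  -- with such a step (`TA-from-just`), so the quotas stay nondecreasing.
  Monotone-decrementAt : ∀ g q → Monotone q → q ‼ g < q ‼ suc g →
                         Monotone (decrementAt (suc g) q)
  Monotone-decrementAt g q mono g< i i<
    rewrite length-decrementAt (suc g) q with i ≟ suc g | suc i ≟ suc g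
  ... | yes refl | _ = begin
    decrementAt (suc g) q ‼ suc g       ≡⟨ decrementAt-same (suc g) q ⟩
    q ‼ suc g ∸ 1                       ≤⟨ m∸n≤m _ 1 ⟩
    q ‼ suc g                           ≤⟨ mono (suc g) i< ⟩
    q ‼ suc (suc g)                     ≡⟨ decrementAt-other (suc g) q 1+n≢n ⟨
    decrementAt (suc g) q ‼ suc (suc g) ∎
    where open ≤-Reasoning
  ... | no i≢ | yes refl = begin
    decrementAt (suc g) q ‼ g     ≡⟨ decrementAt-other (suc g) q i≢ ⟩
    q ‼ g                         ≤⟨ ∸-monoˡ-≤ 1 g< ⟩
    q ‼ suc g ∸ 1                 ≡⟨ decrementAt-same (suc g) q ⟨
    decrementAt (suc g) q ‼ suc g ∎
    where open ≤-Reasoning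
  ... | no i≢ | no i≢′ =
    subst₂ _≤_ (sym (decrementAt-other (suc g) q i≢)) (sym (decrementAt-other (suc g) q i≢′))
           (mono i i<)

  -- Closed forms of Z_L and Z_H

  sum-map-snoc : ∀ (f g : ℕ → ℕ) n →
                 sum (map f (applyUpTo g (suc n))) ≡ sum (map f (applyUpTo g n)) + f (g n)
  sum-map-snoc f g n = begin
    sum (map f (applyUpTo g (suc n)))               ≡⟨ cong (sum ∘ map f) (applyUpTo-∷ʳ g n) ⟨
    sum (map f (applyUpTo g n ∷ʳ g n))              ≡⟨ cong sum (map-++ f (applyUpTo g n) (g n ∷ [])) ⟩
    sum (map f (applyUpTo g n) ++ f (g n) ∷ [])     ≡⟨ sum-++ (map f (applyUpTo g n)) _ ⟩
    sum (map f (applyUpTo g n)) + (f (g n) + 0)     ≡⟨ cong (sum (map f (applyUpTo g n)) +_) (+-identityʳ _) ⟩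
    sum (map f (applyUpTo g n)) + f (g n)           ∎
    where open ≡-Reasoning

  any-snoc : ∀ (f : ℕ → Bool) (g : ℕ → ℕ) n →
             any f (applyUpTo g (suc n)) ≡ any f (applyUpTo g n) ∨ f (g n)
  any-snoc f g zero    = ∨-identityʳ (f (g 0))
  any-snoc f g (suc n) =
    trans (cong (f (g 0) ∨_) (any-snoc f (g ∘ suc) n))
          (sym (∨-assoc (f (g 0)) (any f (applyUpTo (g ∘ suc) n)) (f (g (suc n)))))

  Z-L-suc : ∀ q γ h → Z-L q γ (suc (suc h)) ≡ Z-L q γ (suc h) + q ‼ suc h ⊓ q ‼ (γ ∸ 1)
  Z-L-suc q γ h = sum-map-snoc _ suc h

  -- Up to `g` the minimum is the quota itself; beyond `g` it is `q ‼ g` (`Z-L-step`). So Z_L is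
  -- updated along a row by adding one fixed number.
  Z-L-start : ∀ q → Monotone q → ∀ g → g < length q → Z-L q (suc g) (suc g) ≡ prefix q g
  Z-L-start q mono g g< = go g ≤-refl
    where
    go : ∀ h → h ≤ g → Z-L q (suc g) (suc h) ≡ prefix q h
    go zero    h≤ = refl
    go (suc h) h≤ = trans (Z-L-suc q (suc g) h)
      (cong₂ _+_ (go h (<⇒≤ h≤)) (m≤n⇒m⊓n≡m (‼-mono q mono (≤⇒≤′ h≤) (<⇒≤ g<))))

  Z-L-step : ∀ q → Monotone q → ∀ g d → suc g + d ≤ length q →
             Z-L q (suc g) (suc (suc g + d)) ≡ Z-L q (suc g) (suc g + d) + q ‼ g
  Z-L-step q mono g d ≤k = trans (Z-L-suc q (suc g) (g + d))
    (cong (Z-L q (suc g) (suc g + d) +_)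
          (m≥n⇒m⊓n≡n (‼-mono q mono (≤⇒≤′ (≤-trans (n≤1+n g) (m≤m+n (suc g) d))) ≤k)))

  Z-H-+ : ∀ q γ d → Z-H q γ (γ + d) ≡
          sum (map (λ i → q ‼ i ∸ q ‼ (γ ∸ 1)) (applyUpTo (γ +_) (suc d)))
  Z-H-+ q γ d = cong (λ n → sum (map (λ i → q ‼ i ∸ q ‼ (γ ∸ 1)) (applyUpTo (γ +_) n)))
    (trans (cong (_∸ γ) (sym (+-suc γ d))) (m+n∸m≡n γ (suc d)))

  -- Each index i from `suc g` to h - 1 contributes `q ‼ g` to Z_L and its excess over `q ‼ g` to
  -- Z_H, together `q ‼ i`. At i = h only the excess is present, which is why one `q ‼ g` is added
  -- back.
  Z-total : ∀ q → Monotone q → ∀ g d → suc g + d ≤ length q →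
            Z-L q (suc g) (suc g + d) + Z-H q (suc g) (suc g + d) + q ‼ g ≡ prefix q (suc g + d)
  Z-total q mono g d ≤k rewrite Z-H-+ q (suc g) d = go d ≤k
    where
    f = λ i → q ‼ i ∸ q ‼ g
    H : ℕ → ℕ
    H d = sum (map f (applyUpTo (suc g +_) d))
    lower : ∀ d → suc g + d ≤ length q → q ‼ g ≤ q ‼ (suc g + d)
    lower d = ‼-mono q mono (≤⇒≤′ (≤-trans (n≤1+n g) (m≤m+n (suc g) d)))
    open ≡-Reasoning
    go : ∀ d → suc g + d ≤ length q →
         Z-L q (suc g) (suc g + d) + H (suc d) + q ‼ g ≡ prefix q (suc g + d)
    go zero ≤k rewrite +-identityʳ g = begin
      Z-L q (suc g) (suc g) + (q ‼ suc g ∸ q ‼ g + 0) + q ‼ g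
        ≡⟨ +-assoc (Z-L q (suc g) (suc g)) _ _ ⟩
      Z-L q (suc g) (suc g) + (q ‼ suc g ∸ q ‼ g + 0 + q ‼ g)
        ≡⟨ cong₂ _+_ (Z-L-start q mono g ≤k)
             (trans (cong (_+ q ‼ g) (+-identityʳ _)) (m∸n+n≡m (mono g ≤k))) ⟩
      prefix q g + q ‼ suc g ∎
    go (suc d) ≤k = begin
      Z-L q (suc g) (suc (g + suc d)) + H (suc (suc d)) + q ‼ g
        ≡⟨ cong₂ (λ a b → a + b + q ‼ g)
             (trans (cong (Z-L q (suc g) ∘ suc) (+-suc g d)) (Z-L-step q mono g d ≤k′))
             (sum-map-snoc f (suc g +_) (suc d)) ⟩
      (ZL + q ‼ g) + (H (suc d) + t) + q ‼ g
        ≡⟨ cong (_+ q ‼ g) (+-assoc ZL (q ‼ g) _) ⟩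
      ZL + (q ‼ g + (H (suc d) + t)) + q ‼ g
        ≡⟨ cong (λ z → ZL + z + q ‼ g) (+-comm (q ‼ g) _) ⟩
      ZL + (H (suc d) + t + q ‼ g) + q ‼ g
        ≡⟨ cong (λ z → ZL + z + q ‼ g) (+-assoc (H (suc d)) t (q ‼ g)) ⟩
      ZL + (H (suc d) + (t + q ‼ g)) + q ‼ g
        ≡⟨ cong (λ z → ZL + (H (suc d) + z) + q ‼ g) (m∸n+n≡m (lower (suc d) ≤k)) ⟩
      ZL + (H (suc d) + Q) + q ‼ g
        ≡⟨ cong (_+ q ‼ g) (sym (+-assoc ZL _ Q)) ⟩
      ZL + H (suc d) + Q + q ‼ g
        ≡⟨ +-assoc (ZL + H (suc d)) Q (q ‼ g) ⟩
      ZL + H (suc d) + (Q + q ‼ g)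
        ≡⟨ cong (ZL + H (suc d) +_) (+-comm Q (q ‼ g)) ⟩
      ZL + H (suc d) + (q ‼ g + Q)
        ≡⟨ sym (+-assoc (ZL + H (suc d)) (q ‼ g) Q) ⟩
      ZL + H (suc d) + q ‼ g + Q
        ≡⟨ cong (_+ Q) (go d ≤k′) ⟩
      prefix q (suc g + d) + Q
        ≡⟨ cong (prefix q (suc g + d) +_) (cong (λ z → q ‼ suc z) (+-suc g d)) ⟩
      prefix q (suc (suc g + d))
        ≡⟨ cong (λ z → prefix q (suc z)) (sym (+-suc g d)) ⟩
      prefix q (suc g + suc d) ∎
      where
      ≤k′ : suc g + d ≤ length q
      ≤k′ = ≤-trans (+-monoʳ-≤ (suc g) (n≤1+n d)) ≤k
      ZL = Z-L q (suc g) (suc g + d)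
      Q = q ‼ (suc g + suc d)
      t = Q ∸ q ‼ g

  -- Window ends and how they move

  -- The end of the window inspected for the thresholds g + 1 and h when tm
  -- entries have already been processed.
  windowEnd : List ℕ → (tm g h : ℕ) → ℕ
  windowEnd q tm g h = tm + prefix q h ∸ q ‼ g

  ‼≤prefix : ∀ q g → q ‼ g ≤ prefix q g
  ‼≤prefix q zero    = z≤n
  ‼≤prefix q (suc g) = m≤n+m _ _

  windowEnd-+ : ∀ q tm {g h} → g ≤ h → windowEnd q tm g h + q ‼ g ≡ tm + prefix q h
  windowEnd-+ q tm {g} {h} g≤h = m∸n+n≡m
    (≤-trans (‼≤prefix q g) (≤-trans (prefix-mono q (≤⇒≤′ g≤h)) (m≤n+m _ tm)))

  -- `tm` gains one; the prefix sum loses one exactly when `r ≤ h`, and the subtracted `q ‼ g` loses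
  -- one exactly when `g ≡ r`. As `g < h`, the second loss implies the first, so the end never moves
  -- by two.
  windowEnd-decrementAt : ∀ q tm r {g h} → g < h → 0 < q ‼ r →
                          let e  = windowEnd q tm g h
                              e′ = windowEnd (decrementAt r q) (suc tm) g h
                          in e′ ≡ e ⊎ e′ ≡ suc e
  windowEnd-decrementAt q tm r {g} {h} g<h 0<qr with r ≤? h | g ≟ r
  ... | yes r≤h | yes refl = inj₂ (+-cancelʳ-≡ (q′ ‼ g) _ _ (begin
      e′ + q′ ‼ g              ≡⟨ windowEnd-+ q′ (suc tm) (<⇒≤ g<h) ⟩
      suc (tm + prefix q′ h)   ≡⟨ +-suc tm _ ⟨
      tm + suc (prefix q′ h)   ≡⟨ cong (tm +_) (prefix-decrementAt-≥ r q h 0<qr (≤⇒≤′ r≤h)) ⟩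
      tm + prefix q h          ≡⟨ windowEnd-+ q tm (<⇒≤ g<h) ⟨
      e + q ‼ g                ≡⟨ cong (e +_) (m+[n∸m]≡n 0<qr) ⟨
      e + suc (q ‼ g ∸ 1)      ≡⟨ +-suc e _ ⟩
      suc e + (q ‼ g ∸ 1)      ≡⟨ cong (suc e +_) (decrementAt-same r q) ⟨
      suc e + q′ ‼ g           ∎))
    where
    open ≡-Reasoning
    q′ = decrementAt r q
    e = windowEnd q tm g h
    e′ = windowEnd q′ (suc tm) g h
  ... | yes r≤h | no g≢r = inj₁ (cong₂ _∸_
    (trans (sym (+-suc tm _)) (cong (tm +_) (prefix-decrementAt-≥ r q h 0<qr (≤⇒≤′ r≤h))))
    (decrementAt-other r q {g} g≢r))
  ... | no r≰h | _ = inj₂ (trans (cong₂ _∸_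
    (cong (suc tm +_) (prefix-decrementAt-< r q h (≰⇒> r≰h)))
    (decrementAt-other r q {g} (λ { refl → r≰h (<⇒≤ g<h) })))
    (+-∸-assoc 1 (≤-trans (‼≤prefix q g) (≤-trans (prefix-mono q (≤⇒≤′ (<⇒≤ g<h))) (m≤n+m _ tm)))))

  windowEnd≤ : ∀ q tm {g h} → h ≤ length q → windowEnd q tm g h ≤ tm + sum q
  windowEnd≤ q tm {g} {h} h≤ = ≤-trans (m∸n≤m _ (q ‼ g))
    (+-monoʳ-≤ tm (subst (prefix q h ≤_) (sym (sum≡prefix q)) (prefix-mono q (≤⇒≤′ h≤))))

  windowEnd-Z : ∀ q tm → Monotone q → ∀ g d → suc g + d ≤ length q →
                windowEnd q tm g (suc g + d) ≡
                tm + (Z-L q (suc g) (suc g + d) + Z-H q (suc g) (suc g + d))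
  windowEnd-Z q tm mono g d ≤k = trans
    (cong (λ z → tm + z ∸ q ‼ g) (sym (Z-total q mono g d ≤k)))
    (trans (cong (_∸ q ‼ g) (sym (+-assoc tm _ (q ‼ g)))) (m+n∸n≡m _ (q ‼ g)))

  -- Counting larger entries in windows

  module Threshold (V : StrictTotalOrder 0ℓ 0ℓ 0ℓ) where

    open StrictTotalOrder V using (_<?_; _≈_; irrefl; <-respʳ-≈; <-respˡ-≈; module Eq)
      renaming (Carrier to Value; _<_ to _≺_; asym to ≺-asym; compare to ≺-compare)
    open ThresholdAlgorithm V

    countAbove-suc-> : ∀ s T i {v} → nth T (suc i) ≡ just v → s ≺ v →
                       countAbove s (suc i) T ≡ suc (countAbove s i T)
    countAbove-suc-> s (v ∷ T) zero    refl s≺v with s <? v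
    ... | yes _   = refl
    ... | no ¬s≺v = ⊥-elim (¬s≺v s≺v)
    countAbove-suc-> s (w ∷ T) (suc i) eq s≺v with s <? w
    ... | yes _ = cong suc (countAbove-suc-> s T i eq s≺v)
    ... | no _  = countAbove-suc-> s T i eq s≺v

    countAbove-suc-≯ : ∀ s T i {v} → nth T (suc i) ≡ just v → ¬ s ≺ v →
                       countAbove s (suc i) T ≡ countAbove s i T
    countAbove-suc-≯ s (v ∷ T) zero    refl ¬s≺v with s <? v
    ... | yes s≺v = ⊥-elim (¬s≺v s≺v)
    ... | no _    = refl
    countAbove-suc-≯ s (w ∷ T) (suc i) eq ¬s≺v with s <? w
    ... | yes _ = cong suc (countAbove-suc-≯ s T i eq ¬s≺v)
    ... | no _  = countAbove-suc-≯ s T i eq ¬s≺v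

    countAbove-+ : ∀ s i z T → countAbove s (i + z) T ≡ countAbove s i T + countAbove s z (drop i T)
    countAbove-+ s zero    z T       = refl
    countAbove-+ s (suc i) zero    []      = refl
    countAbove-+ s (suc i) (suc z) []      = refl
    countAbove-+ s (suc i) z (w ∷ T) with s <? w
    ... | yes _ = cong suc (countAbove-+ s i z T)
    ... | no _  = countAbove-+ s i z T

    countAbove≤ : ∀ s i T → countAbove s i T ≤ i
    countAbove≤ s zero    T       = z≤n
    countAbove≤ s (suc i) []      = z≤n
    countAbove≤ s (suc i) (w ∷ T) with s <? w
    ... | yes _ = s≤s (countAbove≤ s i T)
    ... | no _  = m≤n⇒m≤1+n (countAbove≤ s i T)

    countAbove-cong : ∀ {s s′} → s ≈ s′ → ∀ z T → countAbove s z T ≡ countAbove s′ z T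
    countAbove-cong s≈ zero    T       = refl
    countAbove-cong s≈ (suc z) []      = refl
    countAbove-cong {s} {s′} s≈ (suc z) (w ∷ T) with s <? w | s′ <? w
    ... | yes _   | yes _    = cong suc (countAbove-cong s≈ z T)
    ... | yes s≺w | no ¬s′≺w = ⊥-elim (¬s′≺w (<-respˡ-≈ s≈ s≺w))
    ... | no ¬s≺w | yes s′≺w = ⊥-elim (¬s≺w (<-respˡ-≈ (Eq.sym s≈) s′≺w))
    ... | no _    | no _     = countAbove-cong s≈ z T

    countAbove-none : ∀ s z {T} → All (λ v → ¬ s ≺ v) T → countAbove s z T ≡ 0
    countAbove-none s zero    ps       = refl
    countAbove-none s (suc z) []       = refl
    countAbove-none s (suc z) (_∷_ {x = w} p ps) with s <? w
    ... | yes s≺w = ⊥-elim (p s≺w)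
    ... | no _    = countAbove-none s z ps

    module _ {H L : Value} (H≺L : H ≺ L) where

      Binary : Value → Set
      Binary v = v ≈ H ⊎ v ≈ L

      -- Two-valuedness of `T` enters here: three strictly increasing entries would need three
      -- values.
      no-chain : ∀ {u v w} → Binary u → Binary v → Binary w → u ≺ v → ¬ v ≺ w
      no-chain _ (inj₂ v≈L) (inj₂ w≈L) _ v≺w = irrefl (Eq.trans v≈L (Eq.sym w≈L)) v≺w
      no-chain _ (inj₂ v≈L) (inj₁ w≈H) _ v≺w =
        ≺-asym H≺L (<-respˡ-≈ v≈L (<-respʳ-≈ w≈H v≺w))
      no-chain (inj₁ u≈H) (inj₁ v≈H) _ u≺v _ = irrefl (Eq.trans u≈H (Eq.sym v≈H)) u≺v
      no-chain (inj₂ u≈L) (inj₁ v≈H) _ u≺v _ =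
        ≺-asym H≺L (<-respˡ-≈ u≈L (<-respʳ-≈ v≈H u≺v))

      -- An entry above the minimum v₀ is an L, above which there is nothing.
      countAbove-high : ∀ {v₀ s T} i z → Binary v₀ → Binary s → All Binary T → v₀ ≺ s →
                        i + z ≤ length T →
                        countAbove v₀ (i + z) T ∸ length T ≡ countAbove s z (drop i T)
      countAbove-high {v₀} {s} {T} i z bv bs bT v₀≺s ≤n = trans
        (m≤n⇒m∸n≡0 (≤-trans (countAbove≤ v₀ (i + z) T) ≤n))
        (sym (countAbove-none s z (drop⁺ i (All.map (λ bw → no-chain bv bs bw v₀≺s) bT))))

    -- Neither of `s` and `v₀` is below the other, so they are equivalent and count the same
    -- entries; the window count is the count up to its end minus the count up to its beginning.
    countAbove-low : ∀ {v₀ s} i z T → ¬ s ≺ v₀ → ¬ v₀ ≺ s →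
                     countAbove v₀ (i + z) T ∸ countAbove v₀ i T ≡ countAbove s z (drop i T)
    countAbove-low {v₀} {s} i z T ¬s≺v₀ ¬v₀≺s = trans
      (cong (_∸ countAbove v₀ i T) (countAbove-+ v₀ i z T))
      (trans (m+n∸m≡n (countAbove v₀ i T) _) (countAbove-cong v₀≈s z (drop i T)))
      where
      v₀≈s : v₀ ≈ s
      v₀≈s with ≺-compare v₀ s
      ... | tri< lt _ _ = ⊥-elim (¬v₀≺s lt)
      ... | tri≈ _ eq _ = eq
      ... | tri> _ _ gt = ⊥-elim (¬s≺v₀ gt)

    -- Totality of ThresholdAllocation

    -- The equality test has failed for the returned agent, and between nondecreasing quotas unequal
    -- means strictly larger.
    TA-from-just : ∀ q s S → Monotone q → ∀ g {x} → g ≤ length q → TA-from g q s S ≡ just x →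
                   ∃[ y ] x ≡ suc y × y < length q × q ‼ y < q ‼ suc y
    TA-from-just q s S mono (suc g) g≤ eq with q ‼ suc g ≡ᵇ q ‼ g in same
    ... | true = TA-from-just q s S mono g (<⇒≤ g≤) eq
    ... | false with any (accepts q s S (suc g)) (suc g ⋯ length q)
    ...   | false = TA-from-just q s S mono g (<⇒≤ g≤) eq
    TA-from-just q s S mono (suc g) g≤ refl | false | true =
      g , refl , g≤ , ≤∧≢⇒< (mono g g≤) λ e → subst Holds same (≡⇒≡ᵇ _ _ (sym e))

    -- If `q ‼ g` is 0, so are all quotas up to `g`; hence Z_L is 0 at `h = γ` and the test holds
    -- whatever the entries are.
    any-accepts : ∀ q s S → Monotone q → ∀ {g} → g < length q → q ‼ g ≡ 0 →
                  any (accepts q s S (suc g)) (suc g ⋯ length q) ≡ true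
    any-accepts q s S mono {g} g< q≡0 = trans
      (cong (any (accepts q s S (suc g)) ∘ applyUpTo (suc g +_)) (+-∸-assoc 1 g<))
      (cong (_∨ any (accepts q s S (suc g)) (applyUpTo (λ i → suc g + suc i) (length q ∸ suc g)))
            accepted)
      where
      accepted : accepts q s S (suc g) (suc g + 0) ≡ true
      accepted rewrite +-identityʳ g
                     | trans (Z-L-start q mono g g<) (prefix≡0 q mono (<⇒≤ g<) q≡0 g ≤-refl) = refl

    -- Positivity of `q ‼ g` travels down the loop: an equality carries it to the next quota, and a
    -- rejection forces it, since a zero there would have meant acceptance. It cannot reach position
    -- 0, where `q ‼ 0` is 0.
    TA-from-total : ∀ q s S → Monotone q → ∀ g → g ≤ length q → 0 < q ‼ g →
                    ∃[ x ] TA-from g q s S ≡ just x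
    TA-from-total q s S mono (suc g) g≤ 0<q with q ‼ suc g ≡ᵇ q ‼ g in same
    ... | true = TA-from-total q s S mono g (<⇒≤ g≤)
                   (subst (0 <_) (≡ᵇ⇒≡ _ _ (subst Holds (sym same) _)) 0<q)
    ... | false with any (accepts q s S (suc g)) (suc g ⋯ length q) in rejected
    ...   | true  = suc g , refl
    ...   | false = TA-from-total q s S mono g (<⇒≤ g≤) (n≢0⇒n>0 λ q≡0 →
                      contradiction (trans (sym (any-accepts q s S mono g≤ q≡0)) rejected) λ ())

    TA-total : ∀ q s S → Monotone q → 0 < sum q → ∃[ x ] TA q s S ≡ just x
    TA-total q s S mono 0<sum =
      TA-from-total q s S mono (length q) ≤-refl (n≢0⇒n>0 λ q≡0 → <⇒≢ 0<sum
        (sym (trans (sum≡prefix q) (prefix≡0 q mono ≤-refl q≡0 (length q) ≤-refl))))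

    -- The decision in ascending order

    -- The decision of TA computed with increasing instead of decreasing γ = g + 1
    -- and h, a later success overriding an earlier one.
    module _ (q : List ℕ) (s : Value) (S : List Value) where

      inner : (y g d : ℕ) → ℕ
      inner y g zero    = y
      inner y g (suc d) =
        if (q ‼ g <ᵇ q ‼ suc g) ∧ accepts q s S (suc g) (suc g + d)
        then suc g else inner y g d

      best : ℕ → ℕ
      best zero    = 0
      best (suc g) = inner (best g) g (length q ∸ g)

      inner-accept : ∀ y g d → q ‼ g < q ‼ suc g →
                     let γ = suc g; h = γ + d in
                     Z-L q γ h ≤ countAbove s (Z-L q γ h + Z-H q γ h) S →
                     inner y g (suc d) ≡ γ
      inner-accept y g d g< Z≤
        with q ‼ g <ᵇ q ‼ suc g | <⇒<ᵇ g< | accepts q s S (suc g) (suc g + d) | ≤⇒≤ᵇ Z≤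
      ... | true | _ | true | _ = refl

      inner-reject : ∀ y g d →
                     let γ = suc g; h = γ + d in
                     countAbove s (Z-L q γ h + Z-H q γ h) S < Z-L q γ h →
                     inner y g (suc d) ≡ inner y g d
      inner-reject y g d <Z
        with q ‼ g <ᵇ q ‼ suc g | accepts q s S (suc g) (suc g + d)
           | ≤ᵇ⇒≤ (Z-L q (suc g) (suc g + d))
                  (countAbove s (Z-L q (suc g) (suc g + d) + Z-H q (suc g) (suc g + d)) S)
      ... | false | _     | _ = refl
      ... | true  | false | _ = refl
      ... | true  | true  | f = contradiction (f _) (<⇒≱ <Z)

      inner-skip : ∀ y g d → q ‼ suc g ≤ q ‼ g → inner y g (suc d) ≡ inner y g d
      inner-skip y g d g≥ with q ‼ g <ᵇ q ‼ suc g | <ᵇ⇒< (q ‼ g) (q ‼ suc g)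
      ... | false | _ = refl
      ... | true  | f = contradiction (f _) (≤⇒≯ g≥)

      -- Every success in a row writes the same value `suc g`, so running through all `h` gives what
      -- stopping at the first success would.
      inner-any : ∀ y g d → q ‼ g < q ‼ suc g →
                  inner y g d ≡
                  (if any (accepts q s S (suc g)) (applyUpTo (suc g +_) d) then suc g else y)
      inner-any y g zero    g< = refl
      inner-any y g (suc d) g<
        rewrite any-snoc (accepts q s S (suc g)) (suc g +_) d | inner-any y g d g<
        with q ‼ g <ᵇ q ‼ suc g | <⇒<ᵇ g< | accepts q s S (suc g) (suc g + d)
           | any (accepts q s S (suc g)) (applyUpTo (suc g +_) d)
      ... | true | _ | true  | true  = refl
      ... | true | _ | true  | false = refl
      ... | true | _ | false | true  = refl
      ... | true | _ | false | false = refl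

      inner-≮ : ∀ y g d → q ‼ suc g ≤ q ‼ g → inner y g d ≡ y
      inner-≮ y g zero    g≥ = refl
      inner-≮ y g (suc d) g≥ = trans (inner-skip y g d g≥) (inner-≮ y g d g≥)

      best-TA : Monotone q → ∀ g → g ≤ length q → best g ≡ fromMaybe 0 (TA-from g q s S)
      best-TA mono zero    g≤ = refl
      best-TA mono (suc g) g≤ with q ‼ suc g ≡ᵇ q ‼ g in same
      ... | true  = trans (inner-≮ (best g) g (length q ∸ g)
                             (≤-reflexive (≡ᵇ⇒≡ _ _ (subst Holds (sym same) _))))
                          (best-TA mono g (<⇒≤ g≤))
      ... | false
        rewrite inner-any (best g) g (length q ∸ g)
                  (≤∧≢⇒< (mono g g≤) λ e → subst Holds same (≡⇒≡ᵇ _ _ (sym e)))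
        with any (accepts q s S (suc g)) (suc g ⋯ length q)
      ...   | true  = refl
      ...   | false = best-TA mono g (<⇒≤ g≤)

    TA-decision : ∀ q s S → Monotone q → 0 < sum q →
                  ∃[ g ] TA q s S ≡ just (suc g) × g < length q × q ‼ g < q ‼ suc g
    TA-decision q s S mono 0<sum
      with x , TA≡ ← TA-total q s S mono 0<sum
      with g , refl , g< , q< ← TA-from-just q s S mono (length q) ≤-refl TA≡ =
      g , TA≡ , g< , q<

    algorithm1-∷ : ∀ q s S {x y} → TA q s (s ∷ S) ≡ just x → algorithm1 q (s ∷ S) ≡ just y →
                   ∃[ y′ ] y ≡ x ∷ y′ × algorithm1 (decrementAt x q) S ≡ just y′
    algorithm1-∷ q s S {x} TA≡ alg rewrite TA≡ with algorithm1 (decrementAt x q) S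
    algorithm1-∷ q s S TA≡ refl | just y′ = y′ , refl , refl

    algorithm1-total : ∀ q S → Monotone q → length S ≡ sum q → ∃[ y ] algorithm1 q S ≡ just y
    algorithm1-total q []      mono len = [] , refl
    algorithm1-total q (s ∷ S) mono len
      with g , TA≡ , g< , q< ← TA-decision q s (s ∷ S) mono (subst (0 <_) len z<s)
      rewrite TA≡
      with y , alg ← algorithm1-total (decrementAt (suc g) q) S (Monotone-decrementAt g q mono q<)
             (suc-injective (trans len (sym (sum-decrementAt (suc g) q (≤-trans z<s q<) g<))))
      rewrite alg = suc g ∷ y , refl

  -- Memory layout and a program logic with step bounds

  -- The memory whose first n cells are the registers rs, followed by the array A.
  mem : ∀ {n} → Vec ℕ n → Memory → Memory
  mem []       A a       = A a
  mem (v ∷ rs) A zero    = v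
  mem (v ∷ rs) A (suc a) = mem rs A a

  set : ∀ {n} → Vec ℕ n → ℕ → ℕ → Vec ℕ n
  set []       d       v = []
  set (_ ∷ rs) zero    v = v ∷ rs
  set (w ∷ rs) (suc d) v = w ∷ set rs d v

  ≔-eq : ∀ A i v → (A [ i ≔ v ]) i ≡ v
  ≔-eq A i v with i ≡ᵇ i | ≡⇒≡ᵇ i i refl
  ... | true | _ = refl

  ≔-neq : ∀ A {i j} v → j ≢ i → (A [ i ≔ v ]) j ≡ A j
  ≔-neq A {i} {j} v j≢i with j ≡ᵇ i | ≡ᵇ⇒≡ j i
  ... | false | _ = refl
  ... | true  | f with () ← j≢i (f _)

  ≔-cong : ∀ {A B : Memory} d {v w} → A ≗ B → v ≡ w → A [ d ≔ v ] ≗ B [ d ≔ w ]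
  ≔-cong d A≗B v≡w a with a ≡ᵇ d
  ... | true  = v≡w
  ... | false = A≗B a

  mem-set : ∀ {n} (rs : Vec ℕ n) A d v → d < n →
            mem rs A [ d ≔ v ] ≗ mem (set rs d v) A
  mem-set (w ∷ rs) A zero    v d<n     zero    = refl
  mem-set (w ∷ rs) A zero    v d<n     (suc a) = refl
  mem-set (w ∷ rs) A (suc d) v d<n     zero    = refl
  mem-set (w ∷ rs) A (suc d) v (s≤s d<n) (suc a) = mem-set rs A d v d<n a

  mem-array : ∀ {n} (rs : Vec ℕ n) A i → mem rs A (n + i) ≡ A i
  mem-array []       A i = refl
  mem-array (_ ∷ rs) A i = mem-array rs A i

  mem-≔ : ∀ {n} (rs : Vec ℕ n) A i v → mem rs A [ n + i ≔ v ] ≗ mem rs (A [ i ≔ v ])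
  mem-≔ []       A i v a       = refl
  mem-≔ (_ ∷ rs) A i v zero    = refl
  mem-≔ (_ ∷ rs) A i v (suc a) = mem-≔ rs A i v a

  module Execution (V : StrictTotalOrder 0ℓ 0ℓ 0ℓ) (p : Program) (R cap : ℕ)
                   (m : List ℕ) (T : List (StrictTotalOrder.Carrier V))
                   (x : List ℕ) where

    open StrictTotalOrder V using (_<?_) renaming (_<_ to _≺_)
    open Machine V

    -- Memory is described up to pointwise equality, since functions are not
    -- extensional.
    record Runs (l : Label) (rs : Vec ℕ R) (A : Memory) (o : List ℕ) (b : ℕ) : Set where
      field
        run : ∀ {μ} → μ ≗ mem rs A →
              ∃[ t ] t ≤ b × Halts p m T (R + cap) ⟨ l , μ , o ⟩ t x

    open Runs

    private variable
      l l′ d a c v i b : ℕ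
      rs : Vec ℕ R
      A : Memory
      o : List ℕ

    private
      reg : Holds (a <ᵇ R) → a < R + cap
      reg {a} a<R = m≤n⇒m≤n+o cap (<ᵇ⇒< a R a<R)

      cell : ∀ {a} → a ≡ R + i → i < cap → a < R + cap
      cell refl = +-monoʳ-< R

      assign : ∀ rs A {μ v w} → μ ≗ mem rs A → v ≡ w → Holds (d <ᵇ R) →
               μ [ d ≔ v ] ≗ mem (set rs d w) A
      assign {d} rs A {w = w} μ≗ v≡w d<R a =
        trans (≔-cong d μ≗ v≡w a) (mem-set rs A d w (<ᵇ⇒< d R d<R) a)

      then : ∀ {i μ μ′ rs A o′} → Runs l′ rs A o′ b → μ′ ≗ mem rs A →
             fetch p l ≡ just i → All (_< R + cap) (cells i μ) →
             step m T i ⟨ l , μ , o ⟩ ≡ just ⟨ l′ , μ′ , o′ ⟩ →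
             ∃[ t ] t ≤ suc b × Halts p m T (R + cap) ⟨ l , μ , o ⟩ t x
      then r μ≗ f cs st =
        let t , t≤b , h = run r μ≗ in suc t , s≤s t≤b , next f cs st h

    weaken : ∀ {b b′} → b ≤ b′ → Runs l rs A o b → Runs l rs A o b′
    run (weaken b≤b′ r) μ≗ =
      let t , t≤b , h = run r μ≗ in t , ≤-trans t≤b b≤b′ , h

    -- Branches that meet again share one bound; the shorter one is padded to the length of the
    -- longer.
    pad : ∀ n → Runs l rs A o b → Runs l rs A o (n + b)
    pad {b = b} n = weaken (m≤n+m b n)

    run-halt : fetch p l ≡ just halt → Runs l rs A x (suc b)
    run (run-halt f) μ≗ = 1 , s≤s z≤n , stop f

    -- For concrete registers `Holds (d <ᵇ R)` computes to the unit type and is filled in silently,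
    -- and the `fetch` equation holds by `refl`; a proof written with these rules follows the
    -- program text.
    run-const : fetch p l ≡ just (const d v) → {_ : Holds (d <ᵇ R)} →
                Runs (suc l) (set rs d v) A o b → Runs l rs A o (suc b)
    run (run-const {rs = rs} {A} f {d<} r) μ≗ =
      then r (assign rs A μ≗ refl d<) f (reg d< ∷ []) refl

    run-copy : fetch p l ≡ just (copy d a) → {_ : Holds (d <ᵇ R)} {_ : Holds (a <ᵇ R)} →
               Runs (suc l) (set rs d (mem rs A a)) A o b → Runs l rs A o (suc b)
    run (run-copy {a = a} {rs} {A} f {d<} {a<} r) μ≗ =
      then r (assign rs A μ≗ (μ≗ a) d<) f (reg d< ∷ reg a< ∷ []) refl

    run-add : fetch p l ≡ just (add d a c) →
              {_ : Holds (d <ᵇ R)} {_ : Holds (a <ᵇ R)} {_ : Holds (c <ᵇ R)} →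
              Runs (suc l) (set rs d (mem rs A a + mem rs A c)) A o b →
              Runs l rs A o (suc b)
    run (run-add {a = a} {c} {rs} {A} f {d<} {a<} {c<} r) μ≗ =
      then r (assign rs A μ≗ (cong₂ _+_ (μ≗ a) (μ≗ c)) d<)
           f (reg d< ∷ reg a< ∷ reg c< ∷ []) refl

    run-sub : fetch p l ≡ just (sub d a c) →
              {_ : Holds (d <ᵇ R)} {_ : Holds (a <ᵇ R)} {_ : Holds (c <ᵇ R)} →
              Runs (suc l) (set rs d (mem rs A a ∸ mem rs A c)) A o b →
              Runs l rs A o (suc b)
    run (run-sub {a = a} {c} {rs} {A} f {d<} {a<} {c<} r) μ≗ =
      then r (assign rs A μ≗ (cong₂ _∸_ (μ≗ a) (μ≗ c)) d<)
           f (reg d< ∷ reg a< ∷ reg c< ∷ []) refl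

    run-load : fetch p l ≡ just (load d a) → {_ : Holds (d <ᵇ R)} {_ : Holds (a <ᵇ R)} →
               mem rs A a ≡ R + i → i < cap →
               Runs (suc l) (set rs d (A i)) A o b → Runs l rs A o (suc b)
    run (run-load {a = a} {rs} {A} {i} f {d<} {a<} a≡ i< r) {μ} μ≗ =
      then r (assign rs A μ≗ (trans (cong μ μa≡) (trans (μ≗ (R + i)) (mem-array rs A i))) d<)
           f (reg d< ∷ reg a< ∷ cell μa≡ i< ∷ []) refl
      where μa≡ = trans (μ≗ a) a≡

    run-store : fetch p l ≡ just (store a c) → {_ : Holds (a <ᵇ R)} {_ : Holds (c <ᵇ R)} →
                mem rs A a ≡ R + i → i < cap →
                Runs (suc l) rs (A [ i ≔ mem rs A c ]) o b → Runs l rs A o (suc b)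
    run (run-store {a = a} {c} {rs} {A} {i} f {a<} {c<} a≡ i< r) {μ} μ≗ =
      then r stored f (reg a< ∷ reg c< ∷ cell μa≡ i< ∷ []) refl
      where
      μa≡ = trans (μ≗ a) a≡
      stored : μ [ μ a ≔ μ c ] ≗ mem rs (A [ i ≔ mem rs A c ])
      stored rewrite μa≡ = λ z → trans (≔-cong (R + i) μ≗ (μ≗ c) z) (mem-≔ rs A i _ z)

    run-jump : fetch p l ≡ just (jump l′) → Runs l′ rs A o b → Runs l rs A o (suc b)
    run (run-jump f r) μ≗ = then r μ≗ f [] refl

    run-jump< : fetch p l ≡ just (jump< a c l′) → {_ : Holds (a <ᵇ R)} {_ : Holds (c <ᵇ R)} →
                (mem rs A a < mem rs A c → Runs l′ rs A o b) →
                (mem rs A c ≤ mem rs A a → Runs (suc l) rs A o b) →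
                Runs l rs A o (suc b)
    run (run-jump< {l} {a} {c} {l′} {o = o} f {a<} {c<} r r′) {μ} μ≗
      with μ a <ᵇ μ c in eq
    ... | true =
      then (r (subst₂ _<_ (μ≗ a) (μ≗ c) (<ᵇ⇒< _ _ (subst Holds (sym eq) _)))) μ≗ f
           (reg a< ∷ reg c< ∷ [])
           (cong (λ z → just ⟨ (if z then l′ else suc l) , μ , o ⟩) eq)
    ... | false =
      then (r′ (subst₂ _≤_ (μ≗ c) (μ≗ a) (≮⇒≥ λ a<c → subst Holds eq (<⇒<ᵇ a<c)))) μ≗ f
           (reg a< ∷ reg c< ∷ [])
           (cong (λ z → just ⟨ (if z then l′ else suc l) , μ , o ⟩) eq)

    run-getK : fetch p l ≡ just (getK d) → {_ : Holds (d <ᵇ R)} →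
               Runs (suc l) (set rs d (length m)) A o b → Runs l rs A o (suc b)
    run (run-getK {rs = rs} {A} f {d<} r) μ≗ =
      then r (assign rs A μ≗ refl d<) f (reg d< ∷ []) refl

    run-getN : fetch p l ≡ just (getN d) → {_ : Holds (d <ᵇ R)} →
               Runs (suc l) (set rs d (length T)) A o b → Runs l rs A o (suc b)
    run (run-getN {rs = rs} {A} f {d<} r) μ≗ =
      then r (assign rs A μ≗ refl d<) f (reg d< ∷ []) refl

    run-getM : fetch p l ≡ just (getM d a) → {_ : Holds (d <ᵇ R)} {_ : Holds (a <ᵇ R)} →
               nth m (mem rs A a) ≡ just v →
               Runs (suc l) (set rs d v) A o b → Runs l rs A o (suc b)
    run (run-getM {l} {d} {a} {rs} {A} {o = o} f {d<} {a<} m≡ r) {μ} μ≗ =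
      then r (assign rs A μ≗ refl d<) f (reg d< ∷ reg a< ∷ [])
           (cong (_>>= λ w → just ⟨ suc l , μ [ d ≔ w ] , o ⟩)
                 (trans (cong (nth m) (μ≗ a)) m≡))

    run-jumpT< : ∀ {u w} → fetch p l ≡ just (jumpT< a c l′) →
                 {_ : Holds (a <ᵇ R)} {_ : Holds (c <ᵇ R)} →
                 nth T (mem rs A a) ≡ just u → nth T (mem rs A c) ≡ just w →
                 (u ≺ w → Runs l′ rs A o b) →
                 (¬ u ≺ w → Runs (suc l) rs A o b) →
                 Runs l rs A o (suc b)
    run (run-jumpT< {l} {a} {c} {l′} {o = o} {u = u} {w} f {a<} {c<} u≡ w≡ r r′) {μ} μ≗ =
      branch (u <? w) stepped
      where
      after : Dec (u ≺ w) → Config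
      after d = ⟨ (if does d then l′ else suc l) , μ , o ⟩
      stepped : step m T (jumpT< a c l′) ⟨ l , μ , o ⟩ ≡ just (after (u <? w))
      stepped rewrite μ≗ a | μ≗ c | u≡ | w≡ = refl
      branch : (d : Dec (u ≺ w)) →
               step m T (jumpT< a c l′) ⟨ l , μ , o ⟩ ≡ just (after d) → _
      branch (yes u≺w) st = then (r u≺w) μ≗ f (reg a< ∷ reg c< ∷ []) st
      branch (no ¬u≺w) st = then (r′ ¬u≺w) μ≗ f (reg a< ∷ reg c< ∷ []) st

    run-emit : fetch p l ≡ just (emit a) → {_ : Holds (a <ᵇ R)} →
               Runs (suc l) rs A (o ∷ʳ mem rs A a) b → Runs l rs A o (suc b)
    run (run-emit {a = a} {rs} {A} {o} f {a<} r) {μ} μ≗ =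
      then r μ≗ f (reg a< ∷ []) (cong (λ z → just ⟨ _ , μ , o ∷ʳ z ⟩) (μ≗ a))

  -- The program

  -- At time t = tm + 1, for the thresholds γ = g + 1 and h:
  --   rRef     position of a minimal entry of T
  --   rSlack   number of warm-up sweeps left
  --   rC₀      number of L's among T₁, …, T_tm
  --   rD       rC₀ if T_t is H, and n if it is L
  --   rX       the largest accepted γ so far
  --   rG rQ    q_g and q_γ
  --   rPS      q₁ + … + q_g
  --   rRow     address of the row of window ends for γ
  --   rZ rE    Z_L, and the end of the window
  --   rP rP′   addresses
  --   rA rC    window end and count read from the grid; rA is also scratch
  rZero rOne rK rN rRef rTm rSlack rC₀ rU rD rX rΓ rG rQ rPS rRow rZ rE rH rA rP rP′ rC : Address
  rZero = 0
  rOne = 1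
  rK = 2
  rN = 3
  rRef = 4
  rTm = 5
  rSlack = 6
  rC₀ = 7
  rU = 8
  rD = 9
  rX = 10
  rΓ = 11
  rG = 12
  rQ = 13
  rPS = 14
  rRow = 15
  rZ = 16
  rE = 17
  rH = 18
  rA = 19
  rP = 20
  rP′ = 21
  rC = 22

  -- The numbers are the labels of the instructions below them.
  program : Program
  program =
    getN rN ∷
    jump< rZero rN 3 ∷
    halt ∷
    getK rK ∷
    const rOne 1 ∷
    const rRef 1 ∷
    const rH 1 ∷
    -- 7: a minimal entry of T
    jump< rN rH 13 ∷
    jumpT< rH rRef 10 ∷
    jump 11 ∷
    copy rRef rH ∷
    add rH rOne rH ∷
    jump 7 ∷
    -- 13: copying the quotas
    const rH 1 ∷
    const rP 24 ∷
    jump< rK rH 21 ∷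
    getM rA rH ∷
    store rP rA ∷
    add rH rOne rH ∷
    add rP rOne rP ∷
    jump 15 ∷
    copy rSlack rN ∷
    -- 22: next entry of T
    jump< rTm rN 24 ∷
    halt ∷
    -- 24: sweep over all γ and h
    add rU rOne rTm ∷
    copy rD rC₀ ∷
    jumpT< rRef rU 28 ∷
    jump 29 ∷
    copy rD rN ∷
    const rX 0 ∷
    const rΓ 1 ∷
    const rG 0 ∷
    const rPS 0 ∷
    const rRow 23 ∷
    add rRow rRow rK ∷
    -- 35: loop over γ
    jump< rK rΓ 74 ∷
    const rP 23 ∷
    add rP rP rΓ ∷
    load rQ rP ∷
    copy rZ rPS ∷
    add rE rTm rPS ∷
    sub rE rE rG ∷
    copy rH rΓ ∷
    -- 43: loop over h
    jump< rK rH 68 ∷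
    const rP 23 ∷
    add rP rP rH ∷
    load rA rP ∷
    add rE rE rA ∷
    add rP rRow rH ∷
    load rA rP ∷
    add rP′ rP rK ∷
    load rC rP′ ∷
    jump< rA rE 54 ∷
    jump 60 ∷
    -- 54: advancing the pointer
    add rA rOne rA ∷
    store rP rA ∷
    jumpT< rRef rA 58 ∷
    jump 60 ∷
    add rC rOne rC ∷
    store rP′ rC ∷
    -- 60: acceptance test
    sub rA rC rD ∷
    jump< rA rZ 65 ∷
    jump< rG rQ 64 ∷
    jump 65 ∷
    copy rX rΓ ∷
    add rZ rZ rG ∷
    add rH rOne rH ∷
    jump 43 ∷
    -- 68: next γ
    add rPS rPS rQ ∷
    copy rG rQ ∷
    add rRow rRow rK ∷
    add rRow rRow rK ∷
    add rΓ rOne rΓ ∷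
    jump 35 ∷
    -- 74: end of the sweep
    jump< rZero rSlack 86 ∷
    emit rX ∷
    const rP 23 ∷
    add rP rP rX ∷
    load rA rP ∷
    sub rA rA rOne ∷
    store rP rA ∷
    jumpT< rRef rU 83 ∷
    jump 84 ∷
    add rC₀ rOne rC₀ ∷
    add rTm rOne rTm ∷
    jump 22 ∷
    -- 86: end of a warm-up sweep
    sub rSlack rSlack rOne ∷
    jump 24 ∷ []

  -- The grid of pointers and counts

  -- Columns run from 1 to `k`, so `r * k + i` is a positional representation with digits 1, ...,
  -- `k`, which is as unique as the usual one with digits from 0.
  cell-injective : ∀ {k} r r′ {i i′} → 0 < i → i ≤ k → 0 < i′ → i′ ≤ k →
                   r * k + i ≡ r′ * k + i′ → r ≡ r′ × i ≡ i′
  cell-injective zero zero _ _ _ _ eq = refl , eq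
  cell-injective {k} zero (suc r′) {i} {i′} _ i≤k 0<i′ _ eq = contradiction
    (subst (_≤ k) (trans eq (+-assoc k (r′ * k) i′)) i≤k)
    (<⇒≱ (m<m+n k (≤-trans 0<i′ (m≤n+m i′ (r′ * k)))))
  cell-injective {k} (suc r) zero {i} {i′} 0<i _ _ i′≤k eq = contradiction
    (subst (_≤ k) (trans (sym eq) (+-assoc k (r * k) i)) i′≤k)
    (<⇒≱ (m<m+n k (≤-trans 0<i (m≤n+m i (r * k)))))
  cell-injective {k} (suc r) (suc r′) {i} {i′} 0<i i≤k 0<i′ i′≤k eq
    with r≡r′ , i≡i′ ← cell-injective r r′ 0<i i≤k 0<i′ i′≤k
           (+-cancelˡ-≡ k _ _ (trans (sym (+-assoc k (r * k) i)) (trans eq (+-assoc k (r′ * k) i′))))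
    = cong suc r≡r′ , i≡i′

  registers : (k n ref tm slack c₀ u d x γ g qγ ps row z e h a p p′ c : ℕ) → Vec ℕ 23
  registers k n ref tm slack c₀ u d x γ g qγ ps row z e h a p p′ c =
    0 ∷ 1 ∷ k ∷ n ∷ ref ∷ tm ∷ slack ∷ c₀ ∷ u ∷ d ∷ x ∷ γ ∷ g ∷ qγ ∷ ps ∷ row ∷
    z ∷ e ∷ h ∷ a ∷ p ∷ p′ ∷ c ∷ []

  -- Rows 1, 3, 5, … of the grid hold the window ends and rows 2, 4, 6, … the
  -- counts; entry i of row r is at address 23 + (r * k + i).
  endRow countRow : ℕ → ℕ
  endRow   g = suc (2 * g)
  countRow g = suc (suc (2 * g))

  module Simulation (V : StrictTotalOrder 0ℓ 0ℓ 0ℓ) (m : List ℕ)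
                    (T : List (StrictTotalOrder.Carrier V)) (out : List ℕ)
                    (ref : ℕ) (v₀ : StrictTotalOrder.Carrier V)
                    (T-ref : nth T ref ≡ just v₀)
                    (minimal : All (λ v → ¬ StrictTotalOrder._<_ V v v₀) T)
                    {H L : StrictTotalOrder.Carrier V}
                    (H≺L : StrictTotalOrder._<_ V H L)
                    (binary : All (Threshold.Binary V H≺L) T) where

    open StrictTotalOrder V using () renaming (Carrier to Value; _<_ to _≺_)
    open ThresholdAlgorithm V
    open Threshold V

    -- The last row is `countRow (k ∸ 1)`, which has number `2 * k`; its last cell has index
    -- `2 * k * k + k`.
    k n size : ℕ
    k = length m
    n = length T
    size = suc (2 * k * k + k)

    open Execution V program 23 size m T out

    cell : ℕ → ℕ → ℕ
    cell r i = r * k + i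

    cell< : ∀ {r i} → r ≤ 2 * k → i ≤ k → cell r i < size
    cell< r≤ i≤ = s≤s (+-mono-≤ (*-monoˡ-≤ k r≤) i≤)

    countRow≤ : ∀ {g} → g < k → countRow g ≤ 2 * k
    countRow≤ {g} g<k = subst (_≤ 2 * k) (*-suc 2 g) (*-monoʳ-≤ 2 g<k)

    -- Row 0 of the grid holds the current quotas.
    record Quotas (q : List ℕ) (A : Memory) : Set where
      field quota : ∀ {i} → 0 < i → i ≤ k → A (cell 0 i) ≡ q ‼ i

    -- For the pair (g + 1 , h), the entries of T above v₀ have been counted up to
    -- a position that lags behind the end of the window by at most slack.
    record Tracked (q : List ℕ) (tm slack : ℕ) (A : Memory) (g h : ℕ) : Set where
      field
        bounded : A (cell (endRow g) h) ≤ windowEnd q tm g h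
        close   : windowEnd q tm g h ≤ slack + A (cell (endRow g) h)
        counted : A (cell (countRow g) h) ≡ countAbove v₀ (A (cell (endRow g) h)) T

    -- A frame condition: visiting a pair writes at most to its two cells. Columns are restricted to
    -- 1, ..., `k` because beyond that range one cell has several names.
    record AgreeExcept (g h : ℕ) (A B : Memory) : Set where
      field agree : ∀ {r i} → 0 < i → i ≤ k →
                    ¬ (r ≡ endRow g × i ≡ h) → ¬ (r ≡ countRow g × i ≡ h) →
                    B (cell r i) ≡ A (cell r i)

    open Quotas
    open Tracked
    open AgreeExcept

    agree-refl : ∀ {g h A} → AgreeExcept g h A A
    agree-refl = record { agree = λ _ _ _ _ → refl }

    agree-trans : ∀ {g h A B C} → AgreeExcept g h A B → AgreeExcept g h B C → AgreeExcept g h A C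
    agree-trans ab bc = record { agree = λ 0<i i≤k ≢end ≢count →
      trans (agree bc 0<i i≤k ≢end ≢count) (agree ab 0<i i≤k ≢end ≢count) }

    agree-end : ∀ {g h A v} → 0 < h → h ≤ k → AgreeExcept g h A (A [ cell (endRow g) h ≔ v ])
    agree-end {g} {h} {A} {v} 0<h h≤k = record { agree = λ {r} 0<i i≤k ≢end _ →
      ≔-neq A v (≢end ∘ cell-injective r (endRow g) 0<i i≤k 0<h h≤k) }

    agree-count : ∀ {g h A v} → 0 < h → h ≤ k → AgreeExcept g h A (A [ cell (countRow g) h ≔ v ])
    agree-count {g} {h} {A} {v} 0<h h≤k = record { agree = λ {r} 0<i i≤k _ ≢count →
      ≔-neq A v (≢count ∘ cell-injective r (countRow g) 0<i i≤k 0<h h≤k) }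

    endRow≢countRow : ∀ g g′ → endRow g ≢ countRow g′
    endRow≢countRow g g′ eq = even≢odd g g′ (suc-injective eq)

    endRow-injective : ∀ g g′ → endRow g ≡ endRow g′ → g ≡ g′
    endRow-injective g g′ eq = *-cancelˡ-≡ g g′ 2 (suc-injective eq)

    Quotas-agree : ∀ {q g h A B} → AgreeExcept g h A B → Quotas q A → Quotas q B
    Quotas-agree ab quotas = record { quota = λ 0<i i≤k →
      trans (agree ab {0} 0<i i≤k (λ { (() , _) }) (λ { (() , _) })) (quota quotas 0<i i≤k) }

    Tracked-cells : ∀ {q tm slack slack′ A B g h} → B (cell (endRow g) h) ≡ A (cell (endRow g) h) →
                    B (cell (countRow g) h) ≡ A (cell (countRow g) h) → slack ≤ slack′ →
                    Tracked q tm slack A g h → Tracked q tm slack′ B g h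
    Tracked-cells end≡ count≡ slack≤ t = record
      { bounded = subst (_≤ _) (sym end≡) (bounded t)
      ; close   = ≤-trans (close t) (+-mono-≤ slack≤ (≤-reflexive (sym end≡)))
      ; counted = trans count≡ (trans (counted t) (cong (λ e → countAbove v₀ e T) (sym end≡)))
      }

    Tracked-agree : ∀ {q tm slack A B g h g′ h′} → AgreeExcept g h A B → 0 < h′ → h′ ≤ k →
                    ¬ (g′ ≡ g × h′ ≡ h) → Tracked q tm slack A g′ h′ → Tracked q tm slack B g′ h′
    Tracked-agree {g = g} {g′ = g′} ab 0<h′ h′≤k ≢pair = Tracked-cells
      (agree ab 0<h′ h′≤k (λ { (r≡ , h≡) → ≢pair (endRow-injective g′ g r≡ , h≡) })
                          (endRow≢countRow g′ g ∘ proj₁))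
      (agree ab 0<h′ h′≤k (endRow≢countRow g g′ ∘ sym ∘ proj₁)
                          (λ { (r≡ , h≡) → ≢pair (endRow-injective g′ g (suc-injective r≡) , h≡) }))
      ≤-refl

    regs : (tm slack c₀ u d x γ g qγ ps row z e h a p p′ c : ℕ) → Vec ℕ 23
    regs = registers k n ref

    -- One sweep over all pairs

    -- What the acceptance test needs to know about the current entry is packed into `window`:
    -- subtracting `d` from the prefix count at a window end yields the count that `TA` asks for. H
    -- and L differ only in `d`.
    module Sweep (q : List ℕ) (lenq : length q ≡ k) (mono : Monotone q)
                 (tm : ℕ) (budget : tm + sum q ≡ n) (slack c₀ : ℕ)
                 (s : Value) (S : List Value) (d : ℕ)
                 (window : ∀ z → tm + z ≤ n →
                           countAbove v₀ (tm + z) T ∸ d ≡ countAbove s z S)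
                 (o : List ℕ) where

      fits : ∀ {i} → i ≤ k → i ≤ length q
      fits = subst (_ ≤_) (sym lenq)

      -- The pairs lexicographically before (g , h) have been visited.
      record Invariant (A : Memory) (g h : ℕ) : Set where
        field
          quotas  : Quotas q A
          visited : ∀ {g′ h′} → g′ < h′ → h′ ≤ k → g′ < g ⊎ (g′ ≡ g × h′ < h) →
                    Tracked q tm slack A g′ h′
          all     : ∀ {g′ h′} → g′ < h′ → h′ ≤ k → Tracked q tm (suc slack) A g′ h′

      open Invariant

      visit : ∀ {A B g h} → g < h → h ≤ k → AgreeExcept g h A B → Tracked q tm slack B g h →
              Invariant A g h → Invariant B g (suc h)
      visit {A} {B} {g} {h} g<h h≤k agree tracked inv = record
        { quotas = Quotas-agree agree (quotas inv)
        ; visited = λ where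
            g′<h′ h′≤k (inj₁ g′<g) →
              Tracked-agree agree (≤-trans z<s g′<h′) h′≤k (λ { (refl , _) → <-irrefl refl g′<g })
                (visited inv g′<h′ h′≤k (inj₁ g′<g))
            {g′} {h′} g′<h′ h′≤k (inj₂ (refl , h′<1+h)) → at-row g′<h′ h′≤k h′<1+h
        ; all = everywhere
        }
        where
        at-row : ∀ {h′} → g < h′ → h′ ≤ k → h′ < suc h → Tracked q tm slack B g h′
        at-row {h′} g<h′ h′≤k (s≤s h′≤h) with h′ ≟ h
        ... | yes refl = tracked
        ... | no h′≢h = Tracked-agree agree (≤-trans z<s g<h′) h′≤k (h′≢h ∘ proj₂)
                          (visited inv g<h′ h′≤k (inj₂ (refl , ≤∧≢⇒< h′≤h h′≢h)))
        everywhere : ∀ {g′ h′} → g′ < h′ → h′ ≤ k → Tracked q tm (suc slack) B g′ h′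
        everywhere {g′} {h′} g′<h′ h′≤k with g′ ≟ g | h′ ≟ h
        ... | yes refl | yes refl = Tracked-cells refl refl (n≤1+n slack) tracked
        ... | yes _ | no h′≢h =
          Tracked-agree agree (≤-trans z<s g′<h′) h′≤k (h′≢h ∘ proj₂) (all inv g′<h′ h′≤k)
        ... | no g′≢g | _ =
          Tracked-agree agree (≤-trans z<s g′<h′) h′≤k (g′≢g ∘ proj₁) (all inv g′<h′ h′≤k)

      next-row : ∀ {A g h} → k < h → Invariant A g h → Invariant A (suc g) (suc (suc g))
      next-row {A} {g} {h} k<h inv = record
        { quotas = quotas inv
        ; visited = λ where
            g′<h′ h′≤k (inj₁ (s≤s g′≤g)) → earlier g′<h′ h′≤k g′≤g
            g′<h′ h′≤k (inj₂ (refl , h′<)) → contradiction h′< (≤⇒≯ g′<h′)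
        ; all = all inv
        }
        where
        earlier : ∀ {g′ h′} → g′ < h′ → h′ ≤ k → g′ ≤ g → Tracked q tm slack A g′ h′
        earlier {g′} g′<h′ h′≤k g′≤g with g′ ≟ g
        ... | yes g′≡g = visited inv g′<h′ h′≤k (inj₂ (g′≡g , ≤-<-trans h′≤k k<h))
        ... | no g′≢g = visited inv g′<h′ h′≤k (inj₁ (≤∧≢⇒< g′≤g g′≢g))

      module Row (g : ℕ) (g<k : g < k) (ps row : ℕ) (row≡ : row ≡ 23 + endRow g * k) (b : ℕ) where

        state : (x z e h a p p′ c : ℕ) → Vec ℕ 23
        state x = regs tm slack c₀ (suc tm) d x (suc g) (q ‼ g) (q ‼ suc g) ps row

        best-so-far : ℕ → ℕ
        best-so-far = inner q s S (best q s S g) g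

        Finished : Set
        Finished = ∀ {A x z e h a p p′ c} → Invariant A (suc g) (suc (suc g)) →
                   (slack ≡ 0 → x ≡ best q s S (suc g)) →
                   Runs 68 (state x z e h a p p′ c) A o b

        -- `r` is the number of heights left and 22 the length of the longest path through one
        -- iteration. On entry `e` still belongs to the height before `h`; `q ‼ h` is added inside.
        -- The claim on `x` is guarded by `slack ≡ 0`, because counts at lagging pointers decide
        -- nothing.
        heights : Finished → ∀ r j → suc g + j + r ≡ suc k →
                  ∀ {A x z e h a p p′ c} → h ≡ suc g + j → Invariant A g h →
                  (slack ≡ 0 → x ≡ best-so-far j) →
                  z ≡ Z-L q (suc g) h → e + q ‼ g ≡ tm + prefix q (g + j) →
                  Runs 43 (state x z e h a p p′ c) A o (r * 22 + suc b)
        heights finished zero j end {x = x} {h = h} refl inv x≡ z≡ e≡ =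
          run-jump< refl
            (λ k<h → finished (next-row k<h inv) (λ 0≡ → trans (x≡ 0≡) (cong best-so-far j≡)))
            (λ h≤k → contradiction h≤k (<⇒≱ (≤-reflexive (sym h≡))))
          where
          h≡ : suc g + j ≡ suc k
          h≡ = trans (sym (+-identityʳ _)) end
          j≡ : j ≡ length q ∸ g
          j≡ = trans (sym (m+n∸m≡n g j)) (cong (_∸ g) (trans (suc-injective h≡) (sym lenq)))
        heights finished (suc r) j end {A} {x} {z} {e} {h} refl inv x≡ z≡ e≡ =
          run-jump< refl (λ k<h → contradiction h≤k (<⇒≱ k<h)) λ _ →
          run-const refl $ run-add refl $
          run-load refl refl (cell< {0} z≤n h≤k) $
          run-add refl $ run-add refl $
          run-load refl end-address (cell< (<⇒≤ (countRow≤ g<k)) h≤k) $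
          run-add refl $
          run-load refl count-address (cell< (countRow≤ g<k) h≤k) $
          run-jump< refl
            -- A pointer advances only while `e₀ < w ≤ n`, so the entry read at position `suc e₀`
            -- exists.
            (λ e₀<w → let v , T-e = nth-length T {e₀} (≤-trans (subst (e₀ <_) w≡ e₀<w) w≤n) in
              run-add refl $
              run-store refl end-address (cell< (<⇒≤ (countRow≤ g<k)) h≤k) $
              run-jumpT< refl T-ref T-e
                (λ v₀≺v →
                  run-add refl $
                  run-store refl count-address (cell< (countRow≤ g<k) h≤k) $
                  judge (agree-trans agree-end′ agree-count′) (suc e₀) (suc c)
                    (trans (≔-neq A₁ (suc c) end≢count) (≔-eq A (cell (endRow g) h) (suc e₀)))
                    (≔-eq A₁ (cell (countRow g) h) (suc c))
                    -- The advance consumes one unit of slack: `suc slack + e₀` is `slack + suc e₀`.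
                    (subst (e₀ <_) w≡ e₀<w) (subst (w ≤_) (sym (+-suc slack e₀)) (close old))
                    (trans (cong suc (counted old)) (sym (countAbove-suc-> v₀ T e₀ T-e v₀≺v))))
                (λ ¬v₀≺v → pad 1 $ run-jump refl $
                  judge agree-end′ (suc e₀) c
                    (≔-eq A (cell (endRow g) h) (suc e₀))
                    (≔-neq A (suc e₀) (end≢count ∘ sym))
                    (subst (e₀ <_) w≡ e₀<w) (subst (w ≤_) (sym (+-suc slack e₀)) (close old))
                    (trans (counted old) (sym (countAbove-suc-≯ v₀ T e₀ T-e ¬v₀≺v)))))
            (λ w≤e₀ → pad 4 $ run-jump refl $
              judge agree-refl e₀ c refl refl (bounded old)
                (≤-trans (subst (_≤ e₀) w≡ w≤e₀) (m≤n+m e₀ slack)) (counted old))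
          where
          h≤k : h ≤ k
          h≤k = s≤s⁻¹ (subst (h <_) end (m<m+n h z<s))
          g<h : g < h
          g<h = m≤m+n (suc g) j
          e₀ = A (cell (endRow g) h)
          c = A (cell (countRow g) h)
          A₁ = A [ cell (endRow g) h ≔ suc e₀ ]
          e₁ = e + A h
          w = windowEnd q tm g h
          old : Tracked q tm (suc slack) A g h
          old = all inv g<h h≤k
          end≢count : cell (endRow g) h ≢ cell (countRow g) h
          end≢count = endRow≢countRow g g ∘ proj₁ ∘
            cell-injective (endRow g) (countRow g) z<s h≤k z<s h≤k
          agree-end′ : ∀ {v} → AgreeExcept g h A (A [ cell (endRow g) h ≔ v ])
          agree-end′ = agree-end z<s h≤k
          agree-count′ : ∀ {B v} → AgreeExcept g h B (B [ cell (countRow g) h ≔ v ])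
          agree-count′ = agree-count z<s h≤k
          w≤n : w ≤ n
          w≤n = subst (w ≤_) budget (windowEnd≤ q tm {g} (fits h≤k))
          e₁≡ : e₁ + q ‼ g ≡ tm + prefix q h
          e₁≡ = begin
            e + A h + q ‼ g                     ≡⟨ +-assoc e (A h) (q ‼ g) ⟩
            e + (A h + q ‼ g)                   ≡⟨ cong (e +_) (+-comm (A h) (q ‼ g)) ⟩
            e + (q ‼ g + A h)                   ≡⟨ +-assoc e (q ‼ g) (A h) ⟨
            e + q ‼ g + A h                     ≡⟨ cong₂ _+_ e≡ (quota (quotas inv) z<s h≤k) ⟩
            tm + prefix q (g + j) + q ‼ h       ≡⟨ +-assoc tm _ _ ⟩
            tm + prefix q h                     ∎
            where open ≡-Reasoning
          w≡ : e₁ ≡ w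
          w≡ = +-cancelʳ-≡ (q ‼ g) e₁ w (trans e₁≡ (sym (windowEnd-+ q tm (<⇒≤ g<h))))
          end-address : row + h ≡ 23 + cell (endRow g) h
          end-address = trans (cong (_+ h) row≡) (+-assoc 23 (endRow g * k) h)
          count-address : row + h + k ≡ 23 + cell (countRow g) h
          count-address = begin
            row + h + k                      ≡⟨ +-comm (row + h) k ⟩
            k + (row + h)                    ≡⟨ cong (k +_) end-address ⟩
            k + (23 + cell (endRow g) h)     ≡⟨ +-comm k _ ⟩
            23 + (cell (endRow g) h + k)     ≡⟨ cong (23 +_) (+-comm _ k) ⟩
            23 + (k + cell (endRow g) h)     ≡⟨ cong (23 +_) (+-assoc k (endRow g * k) h) ⟨
            23 + cell (countRow g) h         ∎
            where open ≡-Reasoning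
          judge : ∀ {B a p p′} → AgreeExcept g h A B → ∀ e′ c′ →
                  B (cell (endRow g) h) ≡ e′ → B (cell (countRow g) h) ≡ c′ →
                  e′ ≤ w → w ≤ slack + e′ → c′ ≡ countAbove v₀ e′ T →
                  Runs 60 (state x z e₁ h a p p′ c′) B o (7 + (r * 22 + suc b))
          judge {B} ab e′ c′ end≡ count≡ e′≤w w≤ c′≡ =
            run-sub refl $
            run-jump< refl
              (λ lt → pad 2 $ continue λ 0≡ →
                trans (x≡ 0≡) (sym (inner-reject q s S (best q s S g) g j
                  (subst₂ _<_ (count-window 0≡) z≡ lt))))
              (λ ge → run-jump< refl
                (λ g< → run-copy refl $ continue λ 0≡ →
                  sym (inner-accept q s S (best q s S g) g j g< (subst₂ _≤_ z≡ (count-window 0≡) ge)))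
                (λ g≥ → run-jump refl $ continue λ 0≡ →
                  trans (x≡ 0≡) (sym (inner-skip q s S (best q s S g) g j g≥))))
            where
            tracked : Tracked q tm slack B g h
            tracked = record
              { bounded = subst (_≤ w) (sym end≡) e′≤w
              ; close   = subst (λ v → w ≤ slack + v) (sym end≡) w≤
              ; counted = trans count≡ (trans c′≡ (cong (λ v → countAbove v₀ v T) (sym end≡)))
              }
            Z = Z-L q (suc g) h + Z-H q (suc g) h
            w≡Z : w ≡ tm + Z
            w≡Z = windowEnd-Z q tm mono g j (fits h≤k)
            count-window : slack ≡ 0 → c′ ∸ d ≡ countAbove s Z S
            -- Without slack the bounds `e′ ≤ w` and `w ≤ slack + e′` put the pointer exactly at the
            -- window end.
            count-window refl = trans
              (cong (_∸ d) (trans c′≡ (cong (λ v → countAbove v₀ v T) (trans (≤-antisym e′≤w w≤) w≡Z))))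
              (window Z (subst (_≤ n) w≡Z w≤n))
            continue : ∀ {x a p p′} → (slack ≡ 0 → x ≡ best-so-far (suc j)) →
                       Runs 65 (state x z e₁ h a p p′ c′) B o (3 + (r * 22 + suc b))
            continue x≡ =
              run-add refl $ run-add refl $ run-jump refl $
              heights finished r (suc j)
                (trans (cong (_+ r) (cong suc (+-suc g j))) (trans (sym (+-suc h r)) end))
                (sym (cong suc (+-suc g j)))
                (visit g<h h≤k ab tracked inv) x≡
                (trans (cong (_+ q ‼ g) z≡) (sym (Z-L-step q mono g j (fits h≤k))))
                (trans e₁≡ (cong (λ i → tm + prefix q i) (sym (+-suc g j))))

      Swept : ℕ → Set
      Swept b = ∀ {A x γ g qγ ps row z e h a p p′ c} → Quotas q A →
                (∀ {g h} → g < h → h ≤ k → Tracked q tm slack A g h) →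
                (slack ≡ 0 → x ≡ best q s S k) →
                Runs 74 (regs tm slack c₀ (suc tm) d x γ g qγ ps row z e h a p p′ c) A o b

      -- Of the 15 steps outside the loop over `h`, 8 precede it, 1 is its exit test and 6 prepare
      -- the next row. Bounding the `k ∸ g` heights by `k` gives every row the same cost.
      thresholds : ∀ {b} → Swept b → ∀ r g → g + r ≡ k →
                   ∀ {A x qγ row z e h a p p′ c} → row ≡ 23 + endRow g * k →
                   Invariant A g (suc g) → (slack ≡ 0 → x ≡ best q s S g) →
                   Runs 35 (regs tm slack c₀ (suc tm) d x (suc g) (q ‼ g) qγ (prefix q g) row
                                 z e h a p p′ c)
                        A o (r * (15 + k * 22) + suc b)
      thresholds swept zero g end row≡ inv x≡ = run-jump< refl
        (λ _ → swept (quotas inv)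
          (λ g<h h≤k → visited inv g<h h≤k (inj₁ (subst (_ <_) (sym g≡k) (<-≤-trans g<h h≤k))))
          (λ 0≡ → trans (x≡ 0≡) (cong (best q s S) g≡k)))
        (λ g<k → contradiction g≡k (<⇒≢ g<k))
        where
        g≡k : g ≡ k
        g≡k = trans (sym (+-identityʳ g)) end
      thresholds {b} swept (suc r) g end {A} {x} {row = row} {a = a} {p′ = p′} {c} row≡ inv x≡ =
        run-jump< refl (λ k≤g → contradiction g<k (<⇒≱ k≤g)) λ _ →
        run-const refl $ run-add refl $
        run-load refl refl (cell< {0} z≤n g<k) $
        run-copy refl $ run-add refl $ run-sub refl $ run-copy refl $
        subst (λ v → Runs 43 (regs tm slack c₀ (suc tm) d x (suc g) (q ‼ g) v (prefix q g) row
                                 (prefix q g) (windowEnd q tm g g) (suc g) a (23 + suc g) p′ c) A o _)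
              (sym (quota (quotas inv) z<s g<k)) $
        weaken cost $
        Row.heights g g<k (prefix q g) row row≡ (6 + rest)
          (λ inv′ x≡′ →
            run-add refl $ run-copy refl $ run-add refl $ run-add refl $
            run-add refl $ run-jump refl $
            thresholds swept r (suc g) (trans (sym (+-suc g r)) end) next-row≡ inv′ x≡′)
          (k ∸ g) 0
          (trans (cong (_+ (k ∸ g)) (+-identityʳ (suc g))) (cong suc (m+[n∸m]≡n (<⇒≤ g<k))))
          (sym (+-identityʳ (suc g))) inv x≡
          (sym (Z-L-start q mono g (fits g<k)))
          -- The row starts from the window end for the fictitious height `g`, one before the first
          -- real one.
          (trans (windowEnd-+ q tm {g} {g} ≤-refl) (cong (λ i → tm + prefix q i) (sym (+-identityʳ g))))
        where
        rest = r * (15 + k * 22) + suc b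
        g<k : g < k
        g<k = subst (g <_) end (m<m+n g z<s)
        cost : (k ∸ g) * 22 + (7 + rest) ≤ 7 + (k * 22 + r * (15 + k * 22) + suc b)
        cost = begin
          (k ∸ g) * 22 + (7 + rest)    ≤⟨ +-monoˡ-≤ (7 + rest) (*-monoˡ-≤ 22 (m∸n≤m k g)) ⟩
          k * 22 + (7 + rest)          ≡⟨ +-comm (k * 22) (7 + rest) ⟩
          7 + (rest + k * 22)          ≡⟨ cong (7 +_) (+-comm rest (k * 22)) ⟩
          7 + (k * 22 + rest)          ≡⟨ cong (7 +_) (+-assoc (k * 22) _ (suc b)) ⟨
          7 + (k * 22 + r * (15 + k * 22) + suc b) ∎
          where open ≤-Reasoning
        next-row≡ : row + k + k ≡ 23 + endRow (suc g) * k
        next-row≡ = begin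
          row + k + k                    ≡⟨ cong (λ v → v + k + k) row≡ ⟩
          23 + (endRow g * k + k + k)    ≡⟨ cong (23 +_) (+-comm _ k) ⟩
          23 + (k + (endRow g * k + k))  ≡⟨ cong (λ v → 23 + (k + v)) (+-comm _ k) ⟩
          23 + suc (suc (suc (2 * g))) * k ≡⟨ cong (λ v → 23 + suc v * k) (*-suc 2 g) ⟨
          23 + endRow (suc g) * k        ∎
          where open ≡-Reasoning

    -- Decision rounds and warm-up

    record Ready (q : List ℕ) (tm slack : ℕ) (A : Memory) : Set where
      field
        quotas  : Quotas q A
        tracked : ∀ {g h} → g < h → h ≤ k → Tracked q tm slack A g h

    open Ready

    sweepCost : ℕ
    sweepCost = k * (15 + k * 22)

    -- Warm-up and decision sweeps differ only in what happens at label 74, which is left to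
    -- `swept`; in both, the bound on the lag drops by one.
    sweep : ∀ q → length q ≡ k → Monotone q → ∀ tm → tm + sum q ≡ n →
            ∀ {s S} → drop tm T ≡ s ∷ S → ∀ slack {c₀} → c₀ ≡ countAbove v₀ tm T →
            ∀ {o b} →
            (∀ {A u d x γ g qγ ps row z e h a p p′ c} → Ready q tm slack A →
               u ≡ suc tm → (slack ≡ 0 → x ≡ best q s (s ∷ S) k) →
               Runs 74 (regs tm slack c₀ u d x γ g qγ ps row z e h a p p′ c) A o b) →
            ∀ {A u d x γ g qγ ps row z e h a p p′ c} → Ready q tm (suc slack) A →
            Runs 24 (regs tm slack c₀ u d x γ g qγ ps row z e h a p p′ c) A o
                 (10 + (sweepCost + suc b))
    sweep q lenq mono tm budget {s} {S} suffix slack {c₀} refl {o} {b} swept {A} ready =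
      run-add refl $ run-copy refl $
      run-jumpT< refl T-ref T-now
        -- An entry above the minimum is an L. `rD` is then `n`, which no prefix count exceeds, so
        -- all differences truncate to 0.
        (λ v₀≺s → run-copy refl $ rows λ z ≤n →
          trans (countAbove-high H≺L tm z (All-nth binary ref T-ref) (All-nth binary (suc tm) T-now)
                   binary v₀≺s ≤n)
                (cong (countAbove s z) suffix))
        -- Any other entry is equivalent to the minimum; `rD` stays `c₀`, the count among the
        -- entries already processed.
        (λ ¬v₀≺s → run-jump refl $ rows λ z _ →
          trans (countAbove-low tm z T (All-nth minimal (suc tm) T-now) ¬v₀≺s)
                (cong (countAbove s z) suffix))
      where
      T-now : nth T (suc tm) ≡ just s
      T-now = nth-drop T tm suffix
      rows : ∀ {d} → (∀ z → tm + z ≤ n → countAbove v₀ (tm + z) T ∸ d ≡ countAbove s z (s ∷ S)) →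
             ∀ {x γ g qγ ps row z e h a p p′ c} →
             Runs 29 (regs tm slack c₀ (suc tm) d x γ g qγ ps row z e h a p p′ c) A o
                  (6 + (sweepCost + suc b))
      rows {d} window =
        run-const refl $ run-const refl $ run-const refl $ run-const refl $
        run-const refl $ run-add refl $
        thresholds
          (λ quotas′ tracked′ → swept (record { quotas = quotas′ ; tracked = tracked′ }) refl)
          k 0 refl (cong (23 +_) (sym (+-identityʳ k)))
          (record { quotas = quotas ready
                  ; visited = λ { g<h h≤k (inj₂ (refl , h<1)) → contradiction h<1 (≤⇒≯ g<h) }
                  ; all = tracked ready })
          (λ _ → refl)
        where open Sweep q lenq mono tm budget slack c₀ s (s ∷ S) d window o

    -- 22 is 10 steps before the rows, 1 to leave the loop over the rows and 11 to emit the decision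
    -- and update. The test at label 22 is the extra one in `suc roundCost`.
    roundCost : ℕ
    roundCost = 22 + sweepCost

    -- Window ends never move back and move forward by at most one, so exact pointers now lag by at
    -- most one, which is where the next sweep starts. The write to row 0 misses the rows of ends
    -- and counts.
    Ready-decrementAt : ∀ {q tm A g} → g < k → 0 < q ‼ suc g → Ready q tm 0 A →
                        Ready (decrementAt (suc g) q) (suc tm) 1 (A [ cell 0 (suc g) ≔ A (suc g) ∸ 1 ])
    Ready-decrementAt {q} {tm} {A} {g} g<k 0<q ready = record
      { quotas = record { quota = quota′ }
      ; tracked = tracked′
      }
      where
      q′ = decrementAt (suc g) q
      B = A [ cell 0 (suc g) ≔ A (suc g) ∸ 1 ]
      quota′ : ∀ {i} → 0 < i → i ≤ k → B (cell 0 i) ≡ q′ ‼ i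
      quota′ {i} 0<i i≤k with i ≟ suc g
      ... | yes refl = begin
        B (suc g)             ≡⟨ ≔-eq A (suc g) _ ⟩
        A (suc g) ∸ 1         ≡⟨ cong (_∸ 1) (quota (quotas ready) 0<i i≤k) ⟩
        q ‼ suc g ∸ 1         ≡⟨ decrementAt-same (suc g) q ⟨
        q′ ‼ suc g            ∎
        where open ≡-Reasoning
      ... | no i≢ = begin
        B i      ≡⟨ ≔-neq A _ i≢ ⟩
        A i      ≡⟨ quota (quotas ready) 0<i i≤k ⟩
        q ‼ i    ≡⟨ decrementAt-other (suc g) q i≢ ⟨
        q′ ‼ i   ∎
        where open ≡-Reasoning
      untouched : ∀ {r h} → 0 < h → h ≤ k → B (cell (suc r) h) ≡ A (cell (suc r) h)
      untouched {r} {h} 0<h h≤k = ≔-neq A (A (suc g) ∸ 1)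
        ((λ { (() , _) }) ∘ cell-injective (suc r) 0 0<h h≤k z<s g<k)
      tracked′ : ∀ {g′ h} → g′ < h → h ≤ k → Tracked q′ (suc tm) 1 B g′ h
      tracked′ {g′} {h} g′<h h≤k = Tracked-cells (untouched {2 * g′} 0<h h≤k)
        (untouched {suc (2 * g′)} 0<h h≤k) ≤-refl (shifted (windowEnd-decrementAt q tm (suc g) g′<h 0<q))
        where
        0<h = ≤-trans z<s g′<h
        t = tracked ready g′<h h≤k
        w = windowEnd q tm g′ h
        w′ = windowEnd q′ (suc tm) g′ h
        shifted : w′ ≡ w ⊎ w′ ≡ suc w → Tracked q′ (suc tm) 1 A g′ h
        shifted (inj₁ same) = record
          { bounded = ≤-trans (bounded t) (≤-reflexive (sym same))
          ; close   = ≤-trans (≤-reflexive same) (m≤n⇒m≤1+n (close t))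
          ; counted = counted t }
        shifted (inj₂ later) = record
          { bounded = ≤-trans (m≤n⇒m≤1+n (bounded t)) (≤-reflexive (sym later))
          ; close   = ≤-trans (≤-reflexive later) (s≤s (close t))
          ; counted = counted t }

    mutual
      -- The complete output `out` is fixed for all runs, so the induction splits it into the part
      -- `o` already written and the part `y` still to come.
      rounds : ∀ S q → length q ≡ k → Monotone q → length S ≡ sum q →
               ∀ tm → tm + sum q ≡ n → drop tm T ≡ S →
               ∀ {y o} → algorithm1 q S ≡ just y → out ≡ o ++ y →
               ∀ {A c₀ u d x γ g qγ ps row z e h a p p′ c} → c₀ ≡ countAbove v₀ tm T → Ready q tm 1 A →
               Runs 22 (regs tm 0 c₀ u d x γ g qγ ps row z e h a p p′ c) A o
                    (length S * suc roundCost + 2)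
      rounds [] q lenq mono len tm budget suffix {o = o} refl out≡ _ _ =
        run-jump< refl
          (λ tm<n → contradiction tm≡n (<⇒≢ tm<n))
          (λ _ → subst (λ o → Runs 23 _ _ o 1) (trans out≡ (++-identityʳ o)) (run-halt refl))
        where
        tm≡n : tm ≡ n
        tm≡n = trans (sym (+-identityʳ tm)) (trans (cong (tm +_) len) budget)
      rounds (s ∷ S) q lenq mono len tm budget suffix alg out≡ c₀≡ ready =
        run-jump< refl
          (λ _ → weaken (≤-reflexive (sym (+-assoc roundCost _ 2)))
                   (round s S q lenq mono len tm budget suffix alg out≡ c₀≡ ready))
          (λ n≤tm → contradiction n≤tm (<⇒≱ (subst (tm <_) (trans (cong (tm +_) len) budget) (m<m+n tm z<s))))

      -- Kept apart from `rounds` because the first round is entered from the warm-up at label 24,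
      -- past the test at label 22.
      round : ∀ s S q → length q ≡ k → Monotone q → suc (length S) ≡ sum q →
              ∀ tm → tm + sum q ≡ n → drop tm T ≡ s ∷ S →
              ∀ {y o} → algorithm1 q (s ∷ S) ≡ just y → out ≡ o ++ y →
              ∀ {A c₀ u d x γ g qγ ps row z e h a p p′ c} → c₀ ≡ countAbove v₀ tm T → Ready q tm 1 A →
              Runs 24 (regs tm 0 c₀ u d x γ g qγ ps row z e h a p p′ c) A o
                   (roundCost + (length S * suc roundCost + 2))
      round s S q lenq mono len tm budget suffix {y} {o} alg out≡ {c₀ = c₀} c₀≡ ready
        with TA-decision q s (s ∷ S) mono (subst (0 <_) len z<s)
      ... | g , TA≡ , g<len , g<
        with y′ , refl , alg′ ← algorithm1-∷ q s S TA≡ alg =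
        weaken (≤-reflexive cost) $
        sweep q lenq mono tm budget suffix 0 c₀≡
          (λ ready′ u≡ x≡ → emitted ready′ u≡
            (trans (x≡ refl) (trans (cong (best q s (s ∷ S)) (sym lenq))
              (trans (best-TA q s (s ∷ S) mono (length q) ≤-refl) (cong (fromMaybe 0) TA≡)))))
          ready
        where
        q′ = decrementAt (suc g) q
        rest = length S * suc roundCost + 2
        cost : 10 + (sweepCost + suc (11 + rest)) ≡ roundCost + rest
        cost = cong (10 +_) (begin
          sweepCost + (12 + rest)  ≡⟨ +-assoc sweepCost 12 rest ⟨
          sweepCost + 12 + rest    ≡⟨ cong (_+ rest) (+-comm sweepCost 12) ⟩
          12 + sweepCost + rest    ∎)
          where open ≡-Reasoning
        g<k : g < k
        g<k = subst (g <_) lenq g<len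
        0<qγ : 0 < q ‼ suc g
        0<qγ = ≤-trans z<s g<
        sum′ : suc (sum q′) ≡ sum q
        sum′ = sum-decrementAt (suc g) q 0<qγ g<len
        T-now : nth T (suc tm) ≡ just s
        T-now = nth-drop T tm suffix
        emitted : ∀ {A u d x γ g′ qγ ps row z e h a p p′ c} → Ready q tm 0 A → u ≡ suc tm → x ≡ suc g →
                  Runs 74 (regs tm 0 c₀ u d x γ g′ qγ ps row z e h a p p′ c) A o (11 + rest)
        emitted {A} ready′ refl refl =
          run-jump< refl (λ ()) λ _ →
          run-emit refl $ run-const refl $ run-add refl $
          run-load refl refl (cell< {0} z≤n g<k) $
          run-sub refl $
          run-store refl refl (cell< {0} z≤n g<k) $
          run-jumpT< refl T-ref T-now
            (λ v₀≺s → run-add refl $ continue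
              (trans (cong suc c₀≡) (sym (countAbove-suc-> v₀ T tm T-now v₀≺s))))
            (λ ¬v₀≺s → run-jump refl $ continue
              (trans c₀≡ (sym (countAbove-suc-≯ v₀ T tm T-now ¬v₀≺s))))
          where
          continue : ∀ {c₀ u d x γ g′ qγ ps row z e h a p p′ c} → c₀ ≡ countAbove v₀ (suc tm) T →
                     Runs 84 (regs tm 0 c₀ u d x γ g′ qγ ps row z e h a p p′ c)
                          (A [ cell 0 (suc g) ≔ A (suc g) ∸ 1 ]) (o ∷ʳ suc g) (2 + rest)
          continue c₀≡ = run-add refl $ run-jump refl $
            rounds S q′ (trans (length-decrementAt (suc g) q) lenq)
              (Monotone-decrementAt g q mono g<)
              (suc-injective (trans len (sym sum′)))
              (suc tm) (trans (sym (+-suc tm _)) (trans (cong (tm +_) sum′) budget))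
              (drop-suc T tm suffix) alg′
              (trans out≡ (sym (∷ʳ-++ o (suc g) y′))) c₀≡
              (Ready-decrementAt g<k 0<qγ ready′)

    -- The counter is one below the bound on the lag, since the sweep of the first real round
    -- removes the last unit. The 14 is 10 steps before the rows, 1 to leave their loop and 3 to
    -- return to label 24.
    warmup : ∀ slack s S q → length q ≡ k → Monotone q → suc (length S) ≡ sum q →
             sum q ≡ n → T ≡ s ∷ S → algorithm1 q T ≡ just out →
             ∀ {A u d x γ g qγ ps row z e h a p p′ c} → Ready q 0 (suc slack) A →
             Runs 24 (regs 0 slack 0 u d x γ g qγ ps row z e h a p p′ c) A []
                  (slack * (14 + sweepCost) + (roundCost + (length S * suc roundCost + 2)))
    warmup zero s S q lenq mono len budget T≡ alg ready =
      round s S q lenq mono len 0 budget T≡ (subst (λ T → algorithm1 q T ≡ just out) T≡ alg) refl refl ready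
    warmup (suc slack) s S q lenq mono len budget T≡ alg ready =
      weaken (≤-reflexive cost) $
      sweep q lenq mono 0 budget T≡ (suc slack) refl
        (λ ready′ _ _ →
          run-jump< refl
            (λ _ → run-sub refl $ run-jump refl $
              warmup slack s S q lenq mono len budget T≡ alg ready′)
            (λ ()))
        ready
      where
      rest = roundCost + (length S * suc roundCost + 2)
      cost : 10 + (sweepCost + (4 + (slack * (14 + sweepCost) + rest))) ≡
             (14 + sweepCost) + slack * (14 + sweepCost) + rest
      cost = cong (10 +_) (begin
        sweepCost + (4 + (slack * (14 + sweepCost) + rest))
          ≡⟨ +-assoc sweepCost 4 _ ⟨
        sweepCost + 4 + (slack * (14 + sweepCost) + rest)
          ≡⟨ cong (_+ (slack * (14 + sweepCost) + rest)) (+-comm sweepCost 4) ⟩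
        4 + sweepCost + (slack * (14 + sweepCost) + rest)
          ≡⟨ +-assoc (4 + sweepCost) _ rest ⟨
        4 + sweepCost + slack * (14 + sweepCost) + rest ∎)
        where open ≡-Reasoning

    -- The initial state

    untouched-zero : ∀ {r h} → 0 < h → k < cell (suc r) h
    untouched-zero {r} {h} 0<h = subst (k <_) (sym (+-assoc k (r * k) h))
      (m<m+n k (≤-trans 0<h (m≤n+m h (r * k))))

    -- Memory starts at 0, and a pointer at 0 with count 0 is already a correct grid entry, lagging
    -- by at most `sum q`. Only the quotas have to be written.
    unread : ∀ {q A} → sum q ≤ n → length q ≡ k → Quotas q A → (∀ {i} → k < i → A i ≡ 0) →
             Ready q 0 (suc n) A
    unread {q} {A} sum≤n lenq quotas zeros = record
      { quotas = quotas
      ; tracked = λ {g} {h} g<h h≤k →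
          let 0<h   = ≤-trans z<s g<h
              end≡0 = zeros (untouched-zero {2 * g} 0<h)
          in record
            { bounded = ≤-trans (≤-reflexive end≡0) z≤n
            ; close   = ≤-trans (windowEnd≤ q 0 {g} (subst (h ≤_) (sym lenq) h≤k))
                          (≤-trans sum≤n (≤-trans (n≤1+n n) (m≤m+n (suc n) _)))
            ; counted = trans (zeros (untouched-zero {suc (2 * g)} 0<h))
                          (cong (λ e → countAbove v₀ e T) (sym end≡0))
            }
      }

    copying : ∀ {b} →
              (∀ {A h a p} → Quotas m A → (∀ {i} → k < i → A i ≡ 0) →
                 Runs 21 (regs 0 0 0 0 0 0 0 0 0 0 0 0 0 h a p 0 0) A [] b) →
              ∀ r j → j + r ≡ k → ∀ {A h a p} → h ≡ suc j → p ≡ 24 + j →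
              (∀ {i} → 0 < i → i ≤ j → A i ≡ m ‼ i) → (∀ {i} → k < i → A i ≡ 0) →
              Runs 15 (regs 0 0 0 0 0 0 0 0 0 0 0 0 0 h a p 0 0) A [] (r * 6 + suc b)
    copying copied zero j end refl refl quotas zeros = run-jump< refl
      (λ _ → copied (record { quota = λ 0<i i≤k → quotas 0<i (subst (_ ≤_) (sym j≡k) i≤k) }) zeros)
      (λ j<k → contradiction j≡k (<⇒≢ j<k))
      where
      j≡k : j ≡ k
      j≡k = trans (sym (+-identityʳ j)) end
    copying copied (suc r) j end {A} refl refl quotas zeros
      with v , m≡ ← nth-length m {j} (subst (j <_) end (m<m+n j z<s)) =
      run-jump< refl (λ k≤j → contradiction j<k (<⇒≱ k≤j)) λ _ →
      run-getM refl m≡ $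
      run-store refl refl (cell< {0} z≤n j<k) $
      run-add refl $ run-add refl $ run-jump refl $
      copying copied r (suc j) (trans (sym (+-suc j r)) end) refl refl quotas′
        (λ {i} k<i → trans (≔-neq A v (>⇒≢ (<-≤-trans (s≤s j<k) k<i))) (zeros k<i))
      where
      j<k : j < k
      j<k = subst (j <_) end (m<m+n j z<s)
      quotas′ : ∀ {i} → 0 < i → i ≤ suc j → (A [ suc j ≔ v ]) i ≡ m ‼ i
      quotas′ {i} 0<i i≤ with i ≟ suc j
      ... | yes refl = trans (≔-eq A (suc j) v) (sym (cong (fromMaybe 0) m≡))
      ... | no i≢ = trans (≔-neq A v i≢) (quotas 0<i (s≤s⁻¹ (≤∧≢⇒< i≤ i≢)))

    mainCost : ℕ → ℕ
    mainCost n′ = n * (14 + sweepCost) + (roundCost + (n′ * suc roundCost + 2))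

    main : ∀ s S → T ≡ s ∷ S → Monotone m → n ≡ sum m → algorithm1 m T ≡ just out → ∀ {h} →
           Runs 13 (regs 0 0 0 0 0 0 0 0 0 0 0 0 0 h 0 0 0 0) (λ _ → 0) []
                (2 + (k * 6 + (3 + mainCost (length S))))
    main s S T≡ mono n≡ alg = run-const refl $ run-const refl $
      copying
        (λ quotas zeros → run-copy refl $ run-jump< refl
          (λ _ → warmup n s S m refl mono (trans (cong length (sym T≡)) n≡) (sym n≡) T≡ alg
                   (unread (≤-reflexive (sym n≡)) refl quotas zeros))
          (λ n≤0 → contradiction (subst (_≤ 0) (cong length T≡) n≤0) λ ()))
        k 0 refl refl refl (λ 0<i i≤0 → contradiction 0<i (≤⇒≯ i≤0)) (λ _ → refl)

  -- The scan for a minimal entry and the total cost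

  All-from-nth : ∀ {a p} {A : Set a} {P : A → Set p} (xs : List A) →
                 (∀ {i x} → i < length xs → nth xs (suc i) ≡ just x → P x) → All P xs
  All-from-nth []       f = []
  All-from-nth (x ∷ xs) f = f {0} z<s refl ∷ All-from-nth xs (λ i< eq → f (s≤s i<) eq)

  mem-zeros : ∀ n → (λ _ → 0) ≗ mem (replicate n 0) (λ _ → 0)
  mem-zeros zero    a       = refl
  mem-zeros (suc n) zero    = refl
  mem-zeros (suc n) (suc a) = mem-zeros n a

  module Correctness (V : StrictTotalOrder 0ℓ 0ℓ 0ℓ) (m : List ℕ)
                     (T : List (StrictTotalOrder.Carrier V)) (out : List ℕ) where

    open StrictTotalOrder V using () renaming
      (_<_ to _≺_; trans to ≺-trans; irrefl to ≺-irrefl; module Eq to ≈)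
    open ThresholdAlgorithm V
    open Threshold V

    k n size : ℕ
    k = length m
    n = length T
    size = suc (2 * k * k + k)

    open Execution V program 23 size m T out public

    -- Entries cannot be copied to working memory, so the running minimum is kept as a position.
    -- Adopting a smaller entry preserves the earlier comparisons by transitivity.
    scanning : ∀ {b} →
               (∀ {ref v₀ h} → nth T ref ≡ just v₀ → All (λ v → ¬ v ≺ v₀) T →
                  Runs 13 (registers k n ref 0 0 0 0 0 0 0 0 0 0 0 0 0 h 0 0 0 0) (λ _ → 0) [] b) →
               ∀ r j → j + r ≡ n → ∀ {ref v₀ h} → h ≡ suc j → nth T ref ≡ just v₀ →
               (∀ {i v} → i < j → nth T (suc i) ≡ just v → ¬ v ≺ v₀) →
               Runs 7 (registers k n ref 0 0 0 0 0 0 0 0 0 0 0 0 0 h 0 0 0 0) (λ _ → 0) []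
                    (r * 5 + suc b)
    scanning scanned zero j end refl T-ref minimal = run-jump< refl
      (λ _ → scanned T-ref (All-from-nth T (λ i<n → minimal (subst (_ <_) (sym j≡n) i<n))))
      (λ j<n → contradiction j≡n (<⇒≢ j<n))
      where
      j≡n : j ≡ n
      j≡n = trans (sym (+-identityʳ j)) end
    scanning scanned (suc r) j end {v₀ = v₀} refl T-ref minimal
      with v , T-j ← nth-length T {j} (subst (j <_) end (m<m+n j z<s)) =
      run-jump< refl (λ n≤j → contradiction j<n (<⇒≱ n≤j)) λ _ →
      run-jumpT< refl T-j T-ref
        (λ v≺v₀ → run-copy refl $ run-add refl $ run-jump refl $
          scanning scanned r (suc j) end′ refl T-j
            (extend (λ i<j eq v′≺v → minimal i<j eq (≺-trans v′≺v v≺v₀)) (≺-irrefl ≈.refl)))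
        (λ ¬v≺v₀ → run-jump refl $ run-add refl $ run-jump refl $
          scanning scanned r (suc j) end′ refl T-ref (extend minimal ¬v≺v₀))
      where
      j<n : j < n
      j<n = subst (j <_) end (m<m+n j z<s)
      end′ : suc j + r ≡ n
      end′ = trans (sym (+-suc j r)) end
      extend : ∀ {v₁} → (∀ {i w} → i < j → nth T (suc i) ≡ just w → ¬ w ≺ v₁) → ¬ v ≺ v₁ →
               ∀ {i w} → i < suc j → nth T (suc i) ≡ just w → ¬ w ≺ v₁
      extend {v₁} minimal v≮ {i} {w} i<1+j eq with i ≟ j
      ... | yes refl with refl ← trans (sym T-j) eq = v≮
      ... | no i≢j = minimal (≤∧≢⇒< (s≤s⁻¹ i<1+j) i≢j) eq

    totalCost : ℕ → ℕ
    totalCost n′ = 6 + (n * 5 + (3 + (k * 6 + (3 + (n * (14 + W) + (22 + W + (n′ * (23 + W) + 2)))))))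
      where W = k * (15 + k * 22)

    runs : ∀ {H L} (H≺L : H ≺ L) → All (Binary H≺L) T → ∀ s S → T ≡ s ∷ S → Monotone m → n ≡ sum m →
           algorithm1 m T ≡ just out →
           Runs 0 (replicate 23 0) (λ _ → 0) [] (totalCost (length S))
    runs H≺L binary s S T≡ mono n≡ alg =
      run-getN refl $
      run-jump< refl
        (λ _ → run-getK refl $ run-const refl $ run-const refl $ run-const refl $
          scanning
            (λ T-ref minimal → Simulation.main V m T out _ _ T-ref minimal H≺L binary s S T≡ mono n≡ alg)
            -- The candidate is the first entry although nothing has been compared yet, so the scan
            -- begins by comparing it with itself.
            n 0 refl refl (cong (λ T → nth T 1) T≡) (λ ()))
        (λ n≤0 → contradiction (subst (_≤ 0) (cong length T≡) n≤0) λ ())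

  -- In the shifted variables the difference of the two sides has natural coefficients; writing it
  -- out turns the inequality into a ring identity. The tightest coefficient is that of `n`: with
  -- one agent an entry costs 5 + 51 + 60 = 116 steps for scan, warm-up and round, rounded up to
  -- 120.
  totalCost≤ : ∀ n k → let W = suc k * (15 + suc k * 22) in
    6 + (suc n * 5 + (3 + (suc k * 6 + (3 + (suc n * (14 + W) + (22 + W + (n * (23 + W) + 2))))))) ≤
    120 * (1 + suc n * suc k ^ 2)
  totalCost≤ n k = ≤-trans (m≤m+n _ _) (≤-reflexive (solve 2 (λ n k →
     let N = con 1 :+ n; K = con 1 :+ k; W = K :* (con 15 :+ K :* con 22) in
     con 6 :+ (N :* con 5 :+ (con 3 :+ (K :* con 6 :+ (con 3 :+ (N :* (con 14 :+ W) :+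
       (con 22 :+ W :+ (n :* (con 23 :+ W) :+ con 2))))))) :+
       (con 105 :+ con 116 :* k :+ con 76 :* k :* k :+ n :* (con 4 :+ con 122 :* k :+ con 76 :* k :* k))
       := con 120 :* (con 1 :+ N :* K :^ 2)) refl n k))
    where open +-*-Solver

  size≤ : ∀ k → 23 + suc (2 * k * k + k) ≤ 120 * (1 + k ^ 2)
  size≤ zero    = ≤ᵇ⇒≤ 24 120 _
  size≤ (suc k) = ≤-trans (m≤m+n _ _) (≤-reflexive (solve 1 (λ k →
    let K = con 1 :+ k in
    con 23 :+ (con 1 :+ (con 2 :* K :* K :+ K)) :+ (con 213 :+ con 235 :* k :+ con 118 :* k :* k)
    := con 120 :* (con 1 :+ K :^ 2)) refl k))
    where open +-*-Solver

theorem1 :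
  ∃[ p ] ∃[ C ]
    ((V : StrictTotalOrder 0ℓ 0ℓ 0ℓ) →
     let open StrictTotalOrder V
         open ThresholdAlgorithm V
         open Machine V
     in
     (0# H L : Carrier) → (0# < H ⊎ 0# ≈ H) → H < L →
     (m : List ℕ) (T : List Carrier) →
     Sorted ≤-totalOrder m →
     All (λ v → v ≈ H ⊎ v ≈ L) T →
     length T ≡ sum m →
     let k = length m
         n = length T
     in
     ∃[ x ] ∃[ t ] ∃[ s ]
       (algorithm1 m T ≡ just x
        × Computes p m T x t s
        × t ≤ C * (1 + n * k ^ 2)
        × s ≤ C * (1 + k ^ 2)))
theorem1 = program , 120 , correct
  where
  correct : _
  -- Without entries there is no minimal one, and the program halts after 3 steps. The summand 1 in
  -- the time bound pays for this, as `n * k ^ 2` is 0.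
  correct V _ H L _ H≺L m []        sorted binary len =
    let t , t≤ , halts = Correctness.Runs.run empty (mem-zeros 23)
    in [] , t , _ , refl , halts , ≤-trans t≤ (≤ᵇ⇒≤ 3 120 _) , size≤ (length m)
    where
    open Correctness V m [] []
    empty : Runs 0 (replicate 23 0) (λ _ → 0) [] 3
    empty = run-getN refl $ run-jump< refl (λ ()) λ _ → run-halt refl
  -- Without agents the quotas sum to 0. Below there is thus at least one agent, and terms in `n` or
  -- `n * k` are absorbed by `n * k ^ 2`.
  correct V _ H L _ H≺L []      (s ∷ S) sorted binary ()
  correct V _ H L _ H≺L m@(_ ∷ m′) T@(s ∷ S) sorted binary len =
    let mono = Sorted⇒Monotone sorted
        y , alg = Threshold.algorithm1-total V m T mono len
        open Correctness V m T y
        t , t≤ , halts = Runs.run (runs H≺L binary s S refl mono len alg) (mem-zeros 23)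
    in y , t , _ , alg , halts ,
       ≤-trans t≤ (totalCost≤ (length S) (length m′)) , size≤ (length m)
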